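{- Let $m$ be a square-free odd positive integer and let $p$ be a prime with $p>m$. Then $g(\Phi_{mp})=\varphi(m)$.
   Context: $\Phi_n$ denotes the $n$-th cyclotomic polynomial and $\varphi$ is Euler's totient function. For a nonzero polynomial $f=c_1x^{e_1}+\cdots+c_tx^{e_t}$ with $c_1,\dots,c_t\neq 0$ and $e_1<\cdots<e_t$, the maximum gap is $g(f)=\max_{1\le k<t}(e_{k+1}-e_k)$, the largest difference between consecutive exponents occurring in $f$. -}

module Defs where

open import Data.Nat as ℕ using (ℕ; zero; suc; _∸_; _⊔_)
open import Data.Nat.Divisibility using (_∣_; _∣?_)
open import Data.Nat.GCD using (gcd)
open import Data.Integer as ℤ using (ℤ; +_; -_)
open import Data.List using (List; []; _∷_; _++_; [_]; map; foldr; reverse; length; filter; upTo; replicate)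
open import Data.Product using (_×_; _,_)
open import Relation.Nullary.Decidable using (does)
open import Relation.Binary.PropositionalEquality using (_≡_)
open import Data.Bool using (if_then_else_)

-- Polynomials over ℤ as coefficient lists, lowest degree first.
Poly : Set
Poly = List ℤ

_⊕_ : Poly → Poly → Poly
[] ⊕ g = g
(a ∷ f) ⊕ [] = a ∷ f
(a ∷ f) ⊕ (b ∷ g) = (a ℤ.+ b) ∷ (f ⊕ g)

_⊗_ : Poly → Poly → Poly
[] ⊗ g = []
(a ∷ f) ⊗ g = map (a ℤ.*_) g ⊕ (+ 0 ∷ (f ⊗ g))

one : Poly
one = [ + 1 ]

strip : Poly → Poly
strip f = reverse (dropZ (reverse f))
  where
  dropZ : List ℤ → List ℤ
  dropZ [] = []
  dropZ (+ 0 ∷ xs) = dropZ xs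
  dropZ (x ∷ xs) = x ∷ xs

sub : List ℤ → List ℤ → List ℤ
sub [] ys = ys
sub (x ∷ xs) [] = map (-_) (x ∷ xs)
sub (x ∷ xs) (y ∷ ys) = (y ℤ.- x) ∷ sub xs ys

-- Quotient of f by a MONIC polynomial g (long division; remainder discarded).
divMonic : Poly → Poly → Poly
divMonic f g with reverse (strip g)
... | [] = []
... | (_ ∷ bs) = reverse (go (suc (length rf) ∸ length (reverse (strip g))) rf)
  where
  rf : List ℤ
  rf = reverse (strip f)
  go : ℕ → List ℤ → List ℤ
  go zero r = []
  go (suc k) [] = []
  go (suc k) (c ∷ r) = c ∷ go k (sub (map (c ℤ.*_) bs) r)

xⁿ-1 : ℕ → Poly
xⁿ-1 zero = []
xⁿ-1 (suc n) = - (+ 1) ∷ (replicate n (+ 0) ++ [ + 1 ])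

-- cycloList n = [(n, Φ_n), (n-1, Φ_{n-1}), …, (1, Φ_1)], defined by the
-- standard recursion  x^k - 1 = ∏_{d ∣ k} Φ_d,  i.e.
-- Φ_k = (x^k - 1) / ∏_{d ∣ k, d < k} Φ_d.
cycloList : ℕ → List (ℕ × Poly)
cycloList zero = []
cycloList (suc n) = (suc n , divMonic (xⁿ-1 (suc n)) P) ∷ L
  where
  L = cycloList n
  P = foldr (λ { (d , f) acc → if does (d ∣? suc n) then f ⊗ acc else acc }) one L

-- The n-th cyclotomic polynomial (n ≥ 1; Φ 0 is a dummy value 1).
Φ : ℕ → Poly
Φ n with cycloList n
... | [] = one
... | ((_ , f) ∷ _) = f

exponents : Poly → List ℕ
exponents = go 0
  where
  go : ℕ → List ℤ → List ℕ
  go i [] = []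
  go i (+ 0 ∷ cs) = go (suc i) cs
  go i (c ∷ cs) = i ∷ go (suc i) cs

diffs : List ℕ → List ℕ
diffs (x ∷ y ∷ r) = (y ∸ x) ∷ diffs (y ∷ r)
diffs _ = []

-- maximum gap g(f) (0 if f has fewer than two terms)
maxGap : Poly → ℕ
maxGap f = foldr _⊔_ 0 (diffs (exponents f))

φ : ℕ → ℕ
φ n = length (filter (λ k → gcd k n ℕ.≟ 1) (map suc (upTo n)))

SquareFree : ℕ → Set
SquareFree n = ∀ d → d ℕ.* d ∣ n → d ≡ 1

{-# OPTIONS --safe #-}
module Submission where

-- Write F = Φ_m, C = Φ_{mp} and δ = φ(m), so that F(x^p) = F C.
--
-- Upper bound: suppose that two consecutive exponents i < j of C differ by more than δ, put
-- e = i + δ, and cut C = A + x^(e+1) B with deg A = i.  Then F A has degree at most e < j and is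
-- the part of degree ≤ e of F(x^p), that is h(x^p), where h is the part of F of degree ≤ e / p.
-- As x ↦ x^p permutes the primitive m-th roots of unity, F | h(x^p) implies F | h, although
-- h(0) = F(0) ≠ 0 and deg h ≤ e / p < δ.
--
-- Lower bound: with Ψ = (x^m - 1) / F, the identity (x^m - 1) C = F(x^p) Ψ shows that modulo x^p
-- the coefficients of C are those of -F(0) Ψ repeated with period m; deg Ψ = m - δ leaves the
-- exponents m - δ and m consecutive.
--
-- The recursion defining Φ divides exactly: any two of the earlier factors generate an ideal of
-- ℤ[x] containing a nonzero integer, so their monic product divides x^n - 1 up to an integer,
-- hence exactly.

-- Roots of unity never appear: each fact about them is a divisibility in ℤ[x]. The permutation by x
-- ↦ x^p becomes F | F(x^p), and it is inverted because p^(1+t) = 1 + s m for some t and s, while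
-- x^(1+sm) - x is a multiple of x^m - 1 and hence of F. The choice e = i + δ makes the cut of C
-- compatible with multiplication by F: the product F A ends at e, the product F x^(e+1) B starts
-- after it, so the two do not mix. Cutting F(x^p) at any exponent leaves a polynomial in x^p, which
-- is where h comes from. The bound e / p < δ follows from e < j and j ≤ deg C = δ p - δ. The
-- inequality m < p enters in two ways: it gives p ∤ m, on which F(x^p) = F C rests, and it lets a
-- congruence modulo x^p still see the exponent m. That φ(n) is the degree of Φ_n is obtained by
-- subtraction: the factors with smaller index account for the rest of Gauss's totient sum. The
-- degree and the product formula therefore have to be proved in the same induction.

open import Defs renaming (_⊕_ to infixl 6 _⊕_; _⊗_ to infixl 7 _⊗_)
open import Algebra.Bundles using (CommutativeMonoid; CommutativeRing)
open import Data.Bool using (true; false; if_then_else_)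
open import Data.Fin using (toℕ)
open import Data.Fin.Properties using (pigeonhole; toℕ-fromℕ<)
open import Data.Integer as ℤ using (ℤ; +_; 0ℤ; 1ℤ)
import Data.Integer.Properties as ℤₚ
open import Data.Integer.Tactic.RingSolver using (solve-∀)
open import Data.List using (List; []; _∷_; _++_; [_]; map; foldr; reverse; length; replicate; filter; upTo; take; drop)
import Data.List.Properties as Listₚ
open import Data.Maybe using (Maybe; just; nothing)
open import Data.Nat as ℕ using (ℕ; zero; suc; _+_; _*_; _^_; _∸_; _⊔_; _≤_; _<_; z≤n; s≤s)
open import Data.Nat.Coprimality using (Coprime; coprime-divisor)
open import Data.Nat.Divisibility hiding (quotient)
open import Data.Nat.DivMod using (_/_; _%_; _mod_; m≡m%n+[m/n]*n; m%n<n; m/n*n≤m; m<n*o⇒m/o<n)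
open import Data.Nat.GCD using (gcd; gcd[m,n]∣m; gcd[m,n]∣n; gcd[m,n]≤n; c*gcd[m,n]≡gcd[cm,cn]; gcd-GCD; gcd-zeroˡ; module Bézout)
open import Data.Nat.Induction using (<-rec)
open import Data.Nat.Primality using (Prime; prime⇒irreducible; prime⇒nonZero)
import Data.Nat.Properties as ℕₚ
open import Data.Product using (_×_; _,_; ∃; ∃₂; proj₁; proj₂)
open import Data.Sum using (_⊎_; inj₁; inj₂)
open import Function using (_∘_; _$_; it)
open import Function.Bundles using (mk⇔)
open import Level using (0ℓ)
open import Relation.Binary.Definitions using (tri<; tri≈; tri>)
open import Relation.Binary.PropositionalEquality using (_≡_; _≢_; refl; sym; trans; cong; cong₂; subst; subst₂; module ≡-Reasoning)
open import Relation.Nullary using (¬_; Dec; yes; no; contradiction)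
open import Relation.Nullary.Decidable using (does; dec-true; dec-false; does-⇔)
import Tactic.RingSolver as Ring
open import Tactic.RingSolver.Core.AlmostCommutativeRing using (AlmostCommutativeRing; fromCommutativeRing)

-- The ring ℤ[x] of coefficient lists

coef : Poly → ℕ → ℤ
coef []      _       = 0ℤ
coef (a ∷ f) zero    = a
coef (a ∷ f) (suc n) = coef f n

infix 4 _≈_
-- Trailing zeros give one polynomial many lists, so equality is coefficientwise. It is a record so
-- that `f` and `g` can be inferred from a proof.
record _≈_ (f g : Poly) : Set where
  constructor coeffwise
  field at : ∀ n → coef f n ≡ coef g n
open _≈_

≈-refl : ∀ {f} → f ≈ f
≈-refl .at n = refl

≈-sym : ∀ {f g} → f ≈ g → g ≈ f
≈-sym p .at n = sym (p .at n)

≈-trans : ∀ {f g h} → f ≈ g → g ≈ h → f ≈ h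
≈-trans p q .at n = trans (p .at n) (q .at n)

∷-cong : ∀ {a b f g} → a ≡ b → f ≈ g → (a ∷ f) ≈ (b ∷ g)
∷-cong a≡b f≈g .at zero    = a≡b
∷-cong a≡b f≈g .at (suc n) = f≈g .at n

infixr 8 _·_
_·_ : ℤ → Poly → Poly
a · f = map (a ℤ.*_) f

infix 8 ⊝_
⊝_ : Poly → Poly
⊝ f = map ℤ.-_ f

coef-⊕ : ∀ f g n → coef (f ⊕ g) n ≡ coef f n ℤ.+ coef g n
coef-⊕ []      g       n       = sym (ℤₚ.+-identityˡ _)
coef-⊕ (a ∷ f) []      n       = sym (ℤₚ.+-identityʳ _)
coef-⊕ (a ∷ f) (b ∷ g) zero    = refl
coef-⊕ (a ∷ f) (b ∷ g) (suc n) = coef-⊕ f g n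

coef-· : ∀ a f n → coef (a · f) n ≡ a ℤ.* coef f n
coef-· a []      n       = sym (ℤₚ.*-zeroʳ a)
coef-· a (b ∷ f) zero    = refl
coef-· a (b ∷ f) (suc n) = coef-· a f n

coef-⊝ : ∀ f n → coef (⊝ f) n ≡ ℤ.- coef f n
coef-⊝ []      n       = refl
coef-⊝ (b ∷ f) zero    = refl
coef-⊝ (b ∷ f) (suc n) = coef-⊝ f n

⊕-cong : ∀ {f f′ g g′} → f ≈ f′ → g ≈ g′ → f ⊕ g ≈ f′ ⊕ g′
⊕-cong {f} {f′} {g} {g′} p q .at n
  rewrite coef-⊕ f g n | coef-⊕ f′ g′ n = cong₂ ℤ._+_ (p .at n) (q .at n)

·-cong : ∀ a {f g} → f ≈ g → a · f ≈ a · g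
·-cong a {f} {g} q .at n rewrite coef-· a f n | coef-· a g n = cong (a ℤ.*_) (q .at n)

⊝-cong : ∀ {f g} → f ≈ g → ⊝ f ≈ ⊝ g
⊝-cong {f} {g} q .at n rewrite coef-⊝ f n | coef-⊝ g n = cong ℤ.-_ (q .at n)

⊕-comm : ∀ f g → f ⊕ g ≈ g ⊕ f
⊕-comm f g .at n rewrite coef-⊕ f g n | coef-⊕ g f n = ℤₚ.+-comm (coef f n) _

⊕-assoc : ∀ f g h → (f ⊕ g) ⊕ h ≈ f ⊕ (g ⊕ h)
⊕-assoc f g h .at n
  rewrite coef-⊕ (f ⊕ g) h n | coef-⊕ f g n | coef-⊕ f (g ⊕ h) n | coef-⊕ g h n
  = ℤₚ.+-assoc (coef f n) _ _

⊕-identityʳ : ∀ f → f ⊕ [] ≈ f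
⊕-identityʳ []      = ≈-refl
⊕-identityʳ (a ∷ f) = ≈-refl

⊝-inverseʳ : ∀ f → f ⊕ ⊝ f ≈ []
⊝-inverseʳ f .at n rewrite coef-⊕ f (⊝ f) n | coef-⊝ f n = ℤₚ.+-inverseʳ (coef f n)

⊕-interchange : ∀ f g h k → (f ⊕ g) ⊕ (h ⊕ k) ≈ (f ⊕ h) ⊕ (g ⊕ k)
⊕-interchange f g h k .at n
  rewrite coef-⊕ (f ⊕ g) (h ⊕ k) n | coef-⊕ (f ⊕ h) (g ⊕ k) n
        | coef-⊕ f g n | coef-⊕ h k n | coef-⊕ f h n | coef-⊕ g k n
  = lemma (coef f n) (coef g n) (coef h n) (coef k n)
  where
  lemma : ∀ a b c d → (a ℤ.+ b) ℤ.+ (c ℤ.+ d) ≡ (a ℤ.+ c) ℤ.+ (b ℤ.+ d)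
  lemma = solve-∀

·-distrib-⊕ : ∀ a f g → a · (f ⊕ g) ≈ a · f ⊕ a · g
·-distrib-⊕ a f g .at n
  rewrite coef-· a (f ⊕ g) n | coef-⊕ f g n | coef-⊕ (a · f) (a · g) n
        | coef-· a f n | coef-· a g n
  = ℤₚ.*-distribˡ-+ a _ _

·-distribʳ : ∀ a b f → (a ℤ.+ b) · f ≈ a · f ⊕ b · f
·-distribʳ a b f .at n
  rewrite coef-· (a ℤ.+ b) f n | coef-⊕ (a · f) (b · f) n
        | coef-· a f n | coef-· b f n
  = ℤₚ.*-distribʳ-+ (coef f n) a b

·-assoc : ∀ a b f → (a ℤ.* b) · f ≈ a · (b · f)
·-assoc a b f .at n
  rewrite coef-· (a ℤ.* b) f n | coef-· a (b · f) n | coef-· b f n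
  = ℤₚ.*-assoc a b _

0· : ∀ f → 0ℤ · f ≈ []
0· f .at n = coef-· 0ℤ f n

·-shift : ∀ a f → a · (0ℤ ∷ f) ≈ 0ℤ ∷ a · f
·-shift a f = ∷-cong (ℤₚ.*-zeroʳ a) ≈-refl

shift-zero : 0ℤ ∷ [] ≈ []
shift-zero .at zero    = refl
shift-zero .at (suc n) = refl

⊗-congʳ : ∀ f {g h} → g ≈ h → f ⊗ g ≈ f ⊗ h
⊗-congʳ []      p = ≈-refl
⊗-congʳ (a ∷ f) p = ⊕-cong (·-cong a p) (∷-cong refl (⊗-congʳ f p))

⊗-zeroʳ : ∀ f → f ⊗ [] ≈ []
⊗-zeroʳ []      = ≈-refl
⊗-zeroʳ (a ∷ f) = ≈-trans (∷-cong refl (⊗-zeroʳ f)) shift-zero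

⊗-∷ʳ : ∀ f b g → f ⊗ (b ∷ g) ≈ b · f ⊕ (0ℤ ∷ f ⊗ g)
⊗-∷ʳ []      b g = ≈-sym shift-zero
⊗-∷ʳ (a ∷ f) b g =
  ∷-cong (cong (ℤ._+ 0ℤ) (ℤₚ.*-comm a b))
    (≈-trans (⊕-cong ≈-refl (⊗-∷ʳ f b g))
    (≈-trans (≈-sym (⊕-assoc (a · g) (b · f) (0ℤ ∷ f ⊗ g)))
    (≈-trans (⊕-cong (⊕-comm (a · g) (b · f)) ≈-refl)
             (⊕-assoc (b · f) (a · g) (0ℤ ∷ f ⊗ g)))))

⊗-comm : ∀ f g → f ⊗ g ≈ g ⊗ f
⊗-comm []      g = ≈-sym (⊗-zeroʳ g)
⊗-comm (a ∷ f) g =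
  ≈-trans (⊕-cong ≈-refl (∷-cong refl (⊗-comm f g))) (≈-sym (⊗-∷ʳ g a f))

⊗-cong : ∀ {f f′ g g′} → f ≈ f′ → g ≈ g′ → f ⊗ g ≈ f′ ⊗ g′
⊗-cong {f} {f′} {g} {g′} p q =
  ≈-trans (⊗-congʳ f q)
  (≈-trans (⊗-comm f g′) (≈-trans (⊗-congʳ g′ p) (⊗-comm g′ f′)))

⊗-distribʳ-⊕ : ∀ h f g → (f ⊕ g) ⊗ h ≈ f ⊗ h ⊕ g ⊗ h
⊗-distribʳ-⊕ h []      g       = ≈-refl
⊗-distribʳ-⊕ h (a ∷ f) []      = ≈-sym (⊕-identityʳ _)
⊗-distribʳ-⊕ h (a ∷ f) (b ∷ g) =
  ≈-trans (⊕-cong (·-distribʳ a b h) (∷-cong refl (⊗-distribʳ-⊕ h f g)))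
          (⊕-interchange (a · h) (b · h) (0ℤ ∷ f ⊗ h) (0ℤ ∷ g ⊗ h))

⊗-distribˡ-⊕ : ∀ h f g → h ⊗ (f ⊕ g) ≈ h ⊗ f ⊕ h ⊗ g
⊗-distribˡ-⊕ h f g =
  ≈-trans (⊗-comm h (f ⊕ g))
  (≈-trans (⊗-distribʳ-⊕ h f g) (⊕-cong (⊗-comm f h) (⊗-comm g h)))

·-⊗ : ∀ a f g → (a · f) ⊗ g ≈ a · (f ⊗ g)
·-⊗ a []      g = ≈-refl
·-⊗ a (b ∷ f) g =
  ≈-trans (⊕-cong (·-assoc a b g)
                  (≈-trans (∷-cong refl (·-⊗ a f g)) (≈-sym (·-shift a (f ⊗ g)))))
          (≈-sym (·-distrib-⊕ a (b · g) (0ℤ ∷ f ⊗ g)))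

shift-⊗ : ∀ f g → (0ℤ ∷ f) ⊗ g ≈ 0ℤ ∷ f ⊗ g
shift-⊗ f g = ⊕-cong (0· g) (≈-refl {0ℤ ∷ f ⊗ g})

⊗-assoc : ∀ f g h → (f ⊗ g) ⊗ h ≈ f ⊗ (g ⊗ h)
⊗-assoc []      g h = ≈-refl
⊗-assoc (a ∷ f) g h =
  ≈-trans (⊗-distribʳ-⊕ h (a · g) (0ℤ ∷ f ⊗ g))
          (⊕-cong (·-⊗ a g h)
                  (≈-trans (shift-⊗ (f ⊗ g) h) (∷-cong refl (⊗-assoc f g h))))

const : ℤ → Poly
const a = a ∷ []

const-⊗ : ∀ a f → const a ⊗ f ≈ a · f
const-⊗ a f = ≈-trans (⊕-cong (≈-refl {a · f}) shift-zero) (⊕-identityʳ (a · f))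

1· : ∀ f → 1ℤ · f ≈ f
1· f .at n = trans (coef-· 1ℤ f n) (ℤₚ.*-identityˡ _)

⊗-identityˡ : ∀ f → one ⊗ f ≈ f
⊗-identityˡ f = ≈-trans (const-⊗ 1ℤ f) (1· f)

ℤ[x] : CommutativeRing 0ℓ 0ℓ
ℤ[x] = record
  { Carrier = Poly ; _≈_ = _≈_ ; _+_ = _⊕_ ; _*_ = _⊗_ ; -_ = ⊝_ ; 0# = [] ; 1# = one
  ; isCommutativeRing = record
    { isRing = record
      { +-isAbelianGroup = record
        { isGroup = record
          { isMonoid = record
            { isSemigroup = record
              { isMagma = record
                { isEquivalence = record { refl = ≈-refl ; sym = ≈-sym ; trans = ≈-trans }
                ; ∙-cong = ⊕-cong }
              ; assoc = ⊕-assoc }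
            ; identity = (λ f → ≈-refl) , ⊕-identityʳ }
          ; inverse = (λ f → ≈-trans (⊕-comm (⊝ f) f) (⊝-inverseʳ f)) , ⊝-inverseʳ
          ; ⁻¹-cong = ⊝-cong }
        ; comm = ⊕-comm }
      ; *-cong = ⊗-cong
      ; *-assoc = ⊗-assoc
      ; *-identity = ⊗-identityˡ , (λ f → ≈-trans (⊗-comm f one) (⊗-identityˡ f))
      ; distrib = ⊗-distribˡ-⊕ , ⊗-distribʳ-⊕ }
    ; *-comm = ⊗-comm } }

zero? : (f : Poly) → Maybe ([] ≈ f)
zero? []              = just ≈-refl
zero? (+ 0 ∷ f) with zero? f
... | just p          = just (≈-trans (≈-sym shift-zero) (∷-cong refl p))
... | nothing         = nothing
zero? (_ ∷ f)         = nothing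

solverRing : AlmostCommutativeRing 0ℓ 0ℓ
solverRing = fromCommutativeRing ℤ[x] zero?

import Relation.Binary.Reasoning.Setoid (CommutativeRing.setoid ℤ[x]) as ≈-Reasoning

-- Degree bounds and monic polynomials

record Deg< (d : ℕ) (f : Poly) : Set where
  constructor vanishing
  field above : ∀ n → d ≤ n → coef f n ≡ 0ℤ
open Deg<

record Monic (d : ℕ) (f : Poly) : Set where
  constructor monic
  field
    lead : coef f d ≡ 1ℤ
    deg  : Deg< (suc d) f
open Monic

Deg<-≈ : ∀ {d f g} → f ≈ g → Deg< d f → Deg< d g
Deg<-≈ f≈g df .above n d≤n = trans (sym (f≈g .at n)) (df .above n d≤n)

Monic-≈ : ∀ {d f g} → f ≈ g → Monic d f → Monic d g
Monic-≈ f≈g (monic l df) = monic (trans (sym (f≈g .at _)) l) (Deg<-≈ f≈g df)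

Deg<-mono : ∀ {d e f} → d ≤ e → Deg< d f → Deg< e f
Deg<-mono d≤e df .above n e≤n = df .above n (ℕₚ.≤-trans d≤e e≤n)

Deg<-length : ∀ f → Deg< (length f) f
Deg<-length []      .above n       _         = refl
Deg<-length (a ∷ f) .above (suc n) (s≤s l≤n) = Deg<-length f .above n l≤n

Deg<0⇒≈0 : ∀ {f} → Deg< 0 f → f ≈ []
Deg<0⇒≈0 df .at n = df .above n z≤n

coef-⊗-zero : ∀ f g → coef (f ⊗ g) 0 ≡ coef f 0 ℤ.* coef g 0
coef-⊗-zero []      g = refl
coef-⊗-zero (a ∷ f) g =
  trans (coef-⊕ (a · g) (0ℤ ∷ f ⊗ g) 0)
  (trans (ℤₚ.+-identityʳ _) (coef-· a g 0))

coef-∷⊗-suc : ∀ a f g n → coef ((a ∷ f) ⊗ g) (suc n) ≡ a ℤ.* coef g (suc n) ℤ.+ coef (f ⊗ g) n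
coef-∷⊗-suc a f g n =
  trans (coef-⊕ (a · g) (0ℤ ∷ f ⊗ g) (suc n))
        (cong (ℤ._+ coef (f ⊗ g) n) (coef-· a g (suc n)))

Deg<-⊕ : ∀ {d f g} → Deg< d f → Deg< d g → Deg< d (f ⊕ g)
Deg<-⊕ {d} {f} {g} df dg .above n d≤n rewrite coef-⊕ f g n | df .above n d≤n | dg .above n d≤n = refl

Deg<-⊝ : ∀ {d f} → Deg< d f → Deg< d (⊝ f)
Deg<-⊝ {d} {f} df .above n d≤n rewrite coef-⊝ f n | df .above n d≤n = refl

Deg<-· : ∀ {d f} a → Deg< d f → Deg< d (a · f)
Deg<-· {d} {f} a df .above n d≤n rewrite coef-· a f n | df .above n d≤n = ℤₚ.*-zeroʳ a

Deg<-∷ : ∀ {d f} a → Deg< d f → Deg< (suc d) (a ∷ f)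
Deg<-∷ a df .above (suc n) (s≤s d≤n) = df .above n d≤n

Deg<-tail : ∀ {d a f} → Deg< (suc d) (a ∷ f) → Deg< d f
Deg<-tail df .above n d≤n = df .above (suc n) (s≤s d≤n)

-- The bounds are strict for `f` and, through `suc e`, non-strict for `g`. The sum d + e is then a
-- strict bound without any truncated subtraction, and d = 0 covers f = 0.
Deg<-⊗ : ∀ {d e f g} → Deg< d f → Deg< (suc e) g → Deg< (d + e) (f ⊗ g)
Deg<-⊗ {zero} {g = g} df dg .above n _ = ⊗-cong (Deg<0⇒≈0 df) (≈-refl {g}) .at n
Deg<-⊗ {suc d} {e} {[]} df dg .above n _ = refl
Deg<-⊗ {suc d} {e} {a ∷ f} {g} df dg .above (suc n) (s≤s d+e≤n) = begin
  coef ((a ∷ f) ⊗ g) (suc n)                ≡⟨ coef-∷⊗-suc a f g n ⟩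
  a ℤ.* coef g (suc n) ℤ.+ coef (f ⊗ g) n   ≡⟨ cong₂ (λ u v → a ℤ.* u ℤ.+ v)
                                                 (dg .above (suc n) (s≤s (ℕₚ.m+n≤o⇒n≤o d d+e≤n)))
                                                 (Deg<-⊗ {f = f} (Deg<-tail df) dg .above n d+e≤n) ⟩
  a ℤ.* 0ℤ ℤ.+ 0ℤ                           ≡⟨ cong (ℤ._+ 0ℤ) (ℤₚ.*-zeroʳ a) ⟩
  0ℤ                                        ∎
  where open ≡-Reasoning

coef-⊗-top : ∀ {d e f g} → Deg< (suc d) f → Deg< (suc e) g →
             coef (f ⊗ g) (d + e) ≡ coef f d ℤ.* coef g e
coef-⊗-top {f = []} df dg = refl
coef-⊗-top {zero} {e} {a ∷ f} {g} df dg =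
  trans (⊗-cong (∷-cong (refl {x = a}) (Deg<0⇒≈0 (Deg<-tail df))) (≈-refl {g}) .at e)
  (trans (const-⊗ a g .at e) (coef-· a g e))
coef-⊗-top {suc d} {e} {a ∷ f} {g} df dg = begin
  coef ((a ∷ f) ⊗ g) (suc d + e)                     ≡⟨ coef-∷⊗-suc a f g (d + e) ⟩
  a ℤ.* coef g (suc d + e) ℤ.+ coef (f ⊗ g) (d + e)  ≡⟨ cong₂ (λ u v → a ℤ.* u ℤ.+ v)
                                                          (dg .above (suc d + e) (s≤s (ℕₚ.m≤n+m e d)))
                                                          (coef-⊗-top {f = f} (Deg<-tail df) dg) ⟩
  a ℤ.* 0ℤ ℤ.+ coef f d ℤ.* coef g e                 ≡⟨ cong (ℤ._+ _) (ℤₚ.*-zeroʳ a) ⟩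
  0ℤ ℤ.+ coef f d ℤ.* coef g e                       ≡⟨ ℤₚ.+-identityˡ _ ⟩
  coef f d ℤ.* coef g e                              ∎
  where open ≡-Reasoning

Monic-one : Monic 0 one
Monic-one = monic refl (Deg<-length one)

Monic-⊗ : ∀ {d e f g} → Monic d f → Monic e g → Monic (d + e) (f ⊗ g)
Monic-⊗ {f = f} {g} (monic lf df) (monic lg dg) =
  monic (trans (coef-⊗-top {f = f} df dg) (cong₂ ℤ._*_ lf lg)) (Deg<-⊗ {f = f} df dg)

Deg<-pred : ∀ {d f} → Deg< (suc d) f → coef f d ≡ 0ℤ → Deg< d f
Deg<-pred {d} df fd≡0 .above n d≤n with ℕₚ.m≤n⇒m<n∨m≡n d≤n
... | inj₁ d<n  = df .above n d<n
... | inj₂ refl = fd≡0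

-- The length of the list gives a first bound on `q`. As long as a bound `suc b` has b ≥ k, the
-- coefficient of f q at d + b is that of `q` at `b`, which must vanish, so the bound drops by one.
Deg<-cancelˡ : ∀ {d k f q} → Monic d f → Deg< (d + k) (f ⊗ q) → Deg< k q
Deg<-cancelˡ {d} {k} {f} {q} (monic lf df) dfq = descend (length q) (Deg<-length q)
  where
  descend : ∀ b → Deg< b q → Deg< k q
  descend zero    dq = Deg<-mono z≤n dq
  descend (suc b) dq with b ℕ.<? k
  ... | yes b<k = Deg<-mono b<k dq
  ... | no  b≮k = descend b (Deg<-pred dq (begin
    coef q b                ≡⟨ ℤₚ.*-identityˡ _ ⟨
    1ℤ ℤ.* coef q b         ≡⟨ cong (ℤ._* coef q b) lf ⟨
    coef f d ℤ.* coef q b   ≡⟨ coef-⊗-top {f = f} df dq ⟨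
    coef (f ⊗ q) (d + b)    ≡⟨ dfq .above (d + b) (ℕₚ.+-monoʳ-≤ d (ℕₚ.≮⇒≥ b≮k)) ⟩
    0ℤ                      ∎))
    where open ≡-Reasoning

Monic-cancelˡ : ∀ {d e f q} → Monic d f → Monic (d + e) (f ⊗ q) → Monic e q
Monic-cancelˡ {d} {e} {f} {q} mf@(monic lf df) (monic lfq dfq) = monic lq dq
  where
  dq : Deg< (suc e) q
  dq = Deg<-cancelˡ mf (Deg<-mono (ℕₚ.≤-reflexive (sym (ℕₚ.+-suc d e))) dfq)
  lq : coef q e ≡ 1ℤ
  lq = begin
    coef q e                ≡⟨ ℤₚ.*-identityˡ _ ⟨
    1ℤ ℤ.* coef q e         ≡⟨ cong (ℤ._* coef q e) lf ⟨
    coef f d ℤ.* coef q e   ≡⟨ coef-⊗-top {f = f} df dq ⟨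
    coef (f ⊗ q) (d + e)    ≡⟨ lfq ⟩
    1ℤ                      ∎
    where open ≡-Reasoning

Monic-degree-unique : ∀ {d e f} → Monic d f → Monic e f → d ≡ e
Monic-degree-unique {d} {e} (monic ld dd) (monic le de) with ℕₚ.<-cmp d e
... | tri≈ _ d≡e _ = d≡e
... | tri< d<e _ _ with () ← trans (sym le) (dd .above e d<e)
... | tri> _ _ e<d with () ← trans (sym ld) (de .above d e<d)

-- Division by monic polynomials

x⊖y≈0⇒x≈y : ∀ {f g} → f ⊕ ⊝ g ≈ [] → f ≈ g
x⊖y≈0⇒x≈y {f} {g} p = begin
  f                  ≈⟨ add-sub f g ⟩
  (f ⊕ ⊝ g) ⊕ g      ≈⟨ ⊕-cong p ≈-refl ⟩
  g                  ∎
  where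
  open ≈-Reasoning
  add-sub : ∀ f g → f ≈ (f ⊕ ⊝ g) ⊕ g
  add-sub = Ring.solve-∀ solverRing

-- The difference of the two equations is g (q - q′) = r; a nonzero left side would have degree at
-- least `d`. One division is exact because the lemma serves to identify a computed quotient with a
-- known one.
quotient-unique : ∀ {d f g q q′ r} → Monic d g → f ≈ g ⊗ q → f ≈ g ⊗ q′ ⊕ r → Deg< d r → q ≈ q′
quotient-unique {d} {f} {g} {q} {q′} {r} mg f≈gq f≈gq′+r dr =
  x⊖y≈0⇒x≈y (Deg<0⇒≈0 (Deg<-cancelˡ mg
    (Deg<-≈ (≈-sym g[q-q′]≈r) (Deg<-mono (ℕₚ.≤-reflexive (sym (ℕₚ.+-identityʳ d))) dr))))
  where
  open ≈-Reasoning
  expand : ∀ g q q′ → g ⊗ (q ⊕ ⊝ q′) ≈ g ⊗ q ⊕ ⊝ (g ⊗ q′)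
  expand = Ring.solve-∀ solverRing
  collapse : ∀ a r → (a ⊕ r) ⊕ ⊝ a ≈ r
  collapse = Ring.solve-∀ solverRing
  g[q-q′]≈r : g ⊗ (q ⊕ ⊝ q′) ≈ r
  g[q-q′]≈r = begin
    g ⊗ (q ⊕ ⊝ q′)                ≈⟨ expand g q q′ ⟩
    g ⊗ q ⊕ ⊝ (g ⊗ q′)            ≈⟨ ⊕-cong (≈-trans (≈-sym f≈gq) f≈gq′+r) ≈-refl ⟩
    (g ⊗ q′ ⊕ r) ⊕ ⊝ (g ⊗ q′)     ≈⟨ collapse (g ⊗ q′) r ⟩
    r                             ∎

⊗-cancelˡ : ∀ {d f g h} → Monic d f → f ⊗ g ≈ f ⊗ h → g ≈ h
⊗-cancelˡ {f = f} {h = h} mf fg≈fh =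
  quotient-unique {r = []} mf ≈-refl (≈-trans fg≈fh (≈-sym (⊕-identityʳ (f ⊗ h)))) (vanishing λ _ _ → refl)

-- The coefficients are taken from the low end: if f = g q + r, then a + x f = g (x q) + (a + x r),
-- and the new remainder has degree at most `d`, so that one multiple of `g` removes its top term.
divide : ∀ {d g} → Monic d g → ∀ f → ∃₂ λ q r → f ≈ g ⊗ q ⊕ r × Deg< d r
divide {g = g} mg [] = [] , [] , ≈-sym (≈-trans (⊕-identityʳ (g ⊗ [])) (⊗-zeroʳ g)) , vanishing (λ _ _ → refl)
divide {d} {g} mg@(monic lg dg) (a ∷ f) with divide mg f
... | q , r , f≈gq+r , dr = c ∷ q , (a ∷ r) ⊕ ⊝ (c · g) , eq , dr′
  where
  open ≈-Reasoning
  c = coef (a ∷ r) d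
  regroup : ∀ s t u → s ⊕ t ≈ (u ⊕ s) ⊕ (t ⊕ ⊝ u)
  regroup = Ring.solve-∀ solverRing
  eq : a ∷ f ≈ g ⊗ (c ∷ q) ⊕ ((a ∷ r) ⊕ ⊝ (c · g))
  eq = begin
    a ∷ f                                                  ≈⟨ ∷-cong (sym (ℤₚ.+-identityˡ a)) f≈gq+r ⟩
    (0ℤ ∷ g ⊗ q) ⊕ (a ∷ r)                                 ≈⟨ regroup (0ℤ ∷ g ⊗ q) (a ∷ r) (c · g) ⟩
    (c · g ⊕ (0ℤ ∷ g ⊗ q)) ⊕ ((a ∷ r) ⊕ ⊝ (c · g))         ≈⟨ ⊕-cong (⊗-∷ʳ g c q) ≈-refl ⟨
    g ⊗ (c ∷ q) ⊕ ((a ∷ r) ⊕ ⊝ (c · g))                    ∎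
  top : coef ((a ∷ r) ⊕ ⊝ (c · g)) d ≡ 0ℤ
  top rewrite coef-⊕ (a ∷ r) (⊝ (c · g)) d | coef-⊝ (c · g) d | coef-· c g d | lg
    = trans (cong (λ z → c ℤ.+ ℤ.- z) (ℤₚ.*-identityʳ c)) (ℤₚ.+-inverseʳ c)
  dr′ : Deg< d ((a ∷ r) ⊕ ⊝ (c · g))
  dr′ = Deg<-pred (Deg<-⊕ {f = a ∷ r} (Deg<-∷ a dr) (Deg<-⊝ {f = c · g} (Deg<-· {f = g} c dg))) top

infix 4 _∣ₚ_
record _∣ₚ_ (f g : Poly) : Set where
  constructor dividesₚ
  field
    quotient : Poly
    equality : g ≈ f ⊗ quotient
open _∣ₚ_

-- This plays the part of Gauss's lemma. Dividing `h` by the monic `g` with remainder `r` and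
-- multiplying by `N`, uniqueness of the quotient gives N r = 0, and ℤ has no zero divisors.
monic-∣-cancel-const : ∀ {d g h} N .{{_ : ℤ.NonZero N}} → Monic d g → g ∣ₚ N · h → g ∣ₚ h
monic-∣-cancel-const {d} {g} {h} N mg (dividesₚ k Nh≈gk) with divide mg h
... | q , r , h≈gq+r , dr =
  dividesₚ q $ ≈-trans h≈gq+r (≈-trans (⊕-cong (≈-refl {g ⊗ q}) r≈0) (⊕-identityʳ (g ⊗ q)))
  where
  open ≈-Reasoning
  Nh≈ : N · h ≈ g ⊗ (N · q) ⊕ N · r
  Nh≈ = begin
    N · h                   ≈⟨ ·-cong N h≈gq+r ⟩
    N · (g ⊗ q ⊕ r)         ≈⟨ ·-distrib-⊕ N (g ⊗ q) r ⟩
    N · (g ⊗ q) ⊕ N · r     ≈⟨ ⊕-cong (·-cong N (⊗-comm g q)) ≈-refl ⟩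
    N · (q ⊗ g) ⊕ N · r     ≈⟨ ⊕-cong (·-⊗ N q g) ≈-refl ⟨
    (N · q) ⊗ g ⊕ N · r     ≈⟨ ⊕-cong (⊗-comm (N · q) g) ≈-refl ⟩
    g ⊗ (N · q) ⊕ N · r     ∎
  k≈Nq : k ≈ N · q
  k≈Nq = quotient-unique mg Nh≈gk Nh≈ (Deg<-· {f = r} N dr)
  cancel : ∀ s t → t ≈ (s ⊕ t) ⊕ ⊝ s
  cancel = Ring.solve-∀ solverRing
  Nr≈0 : N · r ≈ []
  Nr≈0 = begin
    N · r                                      ≈⟨ cancel (g ⊗ (N · q)) (N · r) ⟩
    (g ⊗ (N · q) ⊕ N · r) ⊕ ⊝ (g ⊗ (N · q))    ≈⟨ ⊕-cong (≈-trans (≈-sym Nh≈) Nh≈gk) ≈-refl ⟩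
    g ⊗ k ⊕ ⊝ (g ⊗ (N · q))                    ≈⟨ ⊕-cong (⊗-congʳ g k≈Nq) ≈-refl ⟩
    g ⊗ (N · q) ⊕ ⊝ (g ⊗ (N · q))              ≈⟨ ⊝-inverseʳ (g ⊗ (N · q)) ⟩
    []                                         ∎
  r≈0 : r ≈ []
  r≈0 .at n = ℤₚ.*-cancelˡ-≡ N _ _
    (trans (sym (coef-· N r n)) (trans (Nr≈0 .at n) (sym (ℤₚ.*-zeroʳ N))))

-- Powers of x and the polynomials xⁿ - 1

X^_ : ℕ → Poly
X^ zero  = one
X^ suc n = 0ℤ ∷ X^ n

Monic-X^ : ∀ n → Monic n (X^ n)
Monic-X^ zero    = Monic-one
Monic-X^ (suc n) with Monic-X^ n
... | monic l d = monic l (Deg<-∷ 0ℤ d)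

X^-+ : ∀ m n → X^ (m + n) ≈ X^ m ⊗ X^ n
X^-+ zero    n = ≈-sym (⊗-identityˡ (X^ n))
X^-+ (suc m) n = ≈-trans (∷-cong refl (X^-+ m n)) (≈-sym (shift-⊗ (X^ m) (X^ n)))

++-⊕ : ∀ f g → f ++ g ≈ f ⊕ X^ length f ⊗ g
++-⊕ []      g = ≈-sym (⊗-identityˡ g)
++-⊕ (a ∷ f) g = ≈-trans
  (∷-cong (sym (ℤₚ.+-identityʳ a)) (++-⊕ f g))
  (⊕-cong (≈-refl {a ∷ f}) (≈-sym (shift-⊗ (X^ length f) g)))

xⁿ-1≈ : ∀ n → xⁿ-1 n ≈ X^ n ⊕ ⊝ one
xⁿ-1≈ zero    .at n = sym (⊝-inverseʳ one .at n)
xⁿ-1≈ (suc n) = ∷-cong refl (≈-trans (tail n) (≈-sym (⊕-identityʳ (X^ n))))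
  where
  tail : ∀ n → replicate n 0ℤ ++ one ≈ X^ n
  tail zero    = ≈-refl
  tail (suc n) = ∷-cong refl (tail n)

Monic-xⁿ-1 : ∀ n → 0 < n → Monic n (xⁿ-1 n)
Monic-xⁿ-1 (suc n) _ = Monic-≈ (≈-sym (xⁿ-1≈ (suc n)))
  (monic (trans (⊕-identityʳ (X^ n) .at n) (Monic-X^ n .lead))
         (Deg<-⊕ {f = X^ suc n} (Monic-X^ (suc n) .deg)
            (Deg<-⊝ {f = one} (Deg<-mono {f = one} (s≤s z≤n) (Deg<-length one)))))

-- Correctness of long division

reverse-∷ : ∀ a f → reverse (a ∷ f) ≈ reverse f ⊕ X^ length f ⊗ const a
reverse-∷ a f = subst₂ (λ r n → r ≈ reverse f ⊕ X^ n ⊗ const a)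
  (sym (Listₚ.unfold-reverse a f)) (Listₚ.length-reverse f) (++-⊕ (reverse f) (const a))

length-sub : ∀ xs ys k → length ys ≡ k + length xs → length (sub xs ys) ≡ length ys
length-sub []       ys       k p = refl
length-sub (x ∷ xs) []       k p = contradiction (sym p) (ℕₚ.m<n⇒n≢0 (ℕₚ.m≤n+m _ k))
length-sub (x ∷ xs) (y ∷ ys) k p =
  cong suc (length-sub xs ys k (ℕₚ.suc-injective (trans p (ℕₚ.+-suc k _))))

-- Both lists run from the highest degree down, so `sub` aligns the leading terms. The `k` entries
-- by which `ys` is longer lie at the low end and turn into the factor x^k.
reverse-sub : ∀ xs ys k → length ys ≡ k + length xs →
              reverse ys ≈ reverse (sub xs ys) ⊕ X^ k ⊗ reverse xs
reverse-sub []       ys       k p =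
  ≈-sym (≈-trans (⊕-cong (≈-refl {reverse ys}) (⊗-zeroʳ (X^ k))) (⊕-identityʳ (reverse ys)))
reverse-sub (x ∷ xs) []       k p = contradiction (sym p) (ℕₚ.m<n⇒n≢0 (ℕₚ.m≤n+m _ k))
reverse-sub (x ∷ xs) (y ∷ ys) k p = begin
  reverse (y ∷ ys)
    ≈⟨ reverse-∷ y ys ⟩
  reverse ys ⊕ X^ length ys ⊗ const y
    ≈⟨ ⊕-cong (reverse-sub xs ys k p′)
              (⊗-congʳ (X^ length ys) (∷-cong (sym (y-x+x y x)) ≈-refl)) ⟩
  (S ⊕ X^ k ⊗ reverse xs) ⊕ X^ length ys ⊗ (const (y ℤ.- x) ⊕ const x)
    ≈⟨ regroup S (X^ k) (reverse xs) (X^ length ys) (const (y ℤ.- x)) (const x) ⟩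
  (S ⊕ X^ length ys ⊗ const (y ℤ.- x)) ⊕ (X^ k ⊗ reverse xs ⊕ X^ length ys ⊗ const x)
    ≈⟨ ⊕-cong (≈-refl {S ⊕ X^ length ys ⊗ const (y ℤ.- x)})
         (⊕-cong (≈-refl {X^ k ⊗ reverse xs})
           (⊗-cong (subst (λ n → X^ n ≈ X^ k ⊗ X^ length xs) (sym p′) (X^-+ k (length xs))) ≈-refl)) ⟩
  (S ⊕ X^ length ys ⊗ const (y ℤ.- x)) ⊕ (X^ k ⊗ reverse xs ⊕ (X^ k ⊗ X^ length xs) ⊗ const x)
    ≈⟨ ⊕-cong
         (subst (λ n → S ⊕ X^ n ⊗ const (y ℤ.- x) ≈ reverse ((y ℤ.- x) ∷ sub xs ys))
            (length-sub xs ys k p′) (≈-sym (reverse-∷ (y ℤ.- x) (sub xs ys))))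
         (factor (X^ k) (reverse xs) (X^ length xs) (const x)) ⟩
  reverse ((y ℤ.- x) ∷ sub xs ys) ⊕ X^ k ⊗ (reverse xs ⊕ X^ length xs ⊗ const x)
    ≈⟨ ⊕-cong (≈-refl {reverse ((y ℤ.- x) ∷ sub xs ys)}) (⊗-congʳ (X^ k) (reverse-∷ x xs)) ⟨
  reverse (sub (x ∷ xs) (y ∷ ys)) ⊕ X^ k ⊗ reverse (x ∷ xs) ∎
  where
  open ≈-Reasoning
  S = reverse (sub xs ys)
  p′ : length ys ≡ k + length xs
  p′ = ℕₚ.suc-injective (trans p (ℕₚ.+-suc k _))
  y-x+x : ∀ y x → (y ℤ.- x) ℤ.+ x ≡ y
  y-x+x = solve-∀
  regroup : ∀ s a b c d e → (s ⊕ a ⊗ b) ⊕ c ⊗ (d ⊕ e) ≈ (s ⊕ c ⊗ d) ⊕ (a ⊗ b ⊕ c ⊗ e)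
  regroup = Ring.solve-∀ solverRing
  factor : ∀ a b c e → a ⊗ b ⊕ (a ⊗ c) ⊗ e ≈ a ⊗ (b ⊕ c ⊗ e)
  factor = Ring.solve-∀ solverRing

-- `strip.dropZ`, `divMonic.go` and `exponents.go` are local to Defs and cannot be named;
-- each is recovered as the unique solution of a unification problem.

mutual
  dropZ : Poly → List ℤ → List ℤ
  dropZ = _

  strip-dropZ : ∀ f → strip f ≡ reverse (dropZ f (reverse f))
  strip-dropZ f with reverse f
  -- Abstracting `reverse` as well leaves a variable at the head: the unifier compares arguments
  -- instead of unfolding, and the unknown function is applied to distinct variables only.
  ... | r with reverse {A = ℤ}
  ... | rev = refl {x = rev (dropZ f r)}

mutual
  longDivision : Poly → Poly → ℤ → List ℤ → ℕ → List ℤ → List ℤ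
  longDivision = _

  divReversed : Poly → Poly → List ℤ → Poly
  divReversed f g []       = []
  divReversed f g (c ∷ bs) = reverse (longDivision f g c bs
    (suc (length (reverse (strip f))) ∸ length (reverse (strip g))) (reverse (strip f)))

  divMonic-divReversed : ∀ f g → divMonic f g ≡ divReversed f g (reverse (strip g))
  divMonic-divReversed f g with reverse (strip g)
  ... | [] = refl
  ... | (c ∷ bs) with suc (length (reverse (strip f))) ∸ length (reverse (strip g))
  ... | k with reverse (strip f)
  ... | r with reverse {A = ℤ}
  ... | rev = refl {x = rev (longDivision f g c bs k r)}

mutual
  exponentsFrom : ℕ → List ℤ → List ℕ
  exponentsFrom = _

  exponents-exponentsFrom : ∀ f → exponents f ≡ exponentsFrom 0 f
  exponents-exponentsFrom f with 0
  ... | k = refl {x = exponentsFrom k f}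

dropZ-≈ : ∀ f r → reverse (dropZ f r) ≈ reverse r
dropZ-≈ f [] = ≈-refl
dropZ-≈ f (+ 0 ∷ r) = ≈-trans (dropZ-≈ f r) (≈-sym (≈-trans (reverse-∷ 0ℤ r)
  (≈-trans (⊕-cong (≈-refl {reverse r})
             (≈-trans (⊗-congʳ (X^ length r) shift-zero) (⊗-zeroʳ (X^ length r))))
           (⊕-identityʳ (reverse r)))))
dropZ-≈ f (ℤ.+[1+ n ] ∷ r) = ≈-refl
dropZ-≈ f (ℤ.-[1+ n ] ∷ r) = ≈-refl

strip-≈ : ∀ f → strip f ≈ f
strip-≈ f = subst₂ _≈_ (sym (strip-dropZ f)) (Listₚ.reverse-involutive f) (dropZ-≈ f (reverse f))

dropZ-head : ∀ f r → dropZ f r ≡ [] ⊎ ∃₂ λ c bs → dropZ f r ≡ c ∷ bs × c ≢ 0ℤ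
dropZ-head f []               = inj₁ refl
dropZ-head f (+ 0 ∷ r)        = dropZ-head f r
dropZ-head f (ℤ.+[1+ n ] ∷ r) = inj₂ (_ , _ , refl , λ ())
dropZ-head f (ℤ.-[1+ n ] ∷ r) = inj₂ (_ , _ , refl , λ ())

reverse-strip : ∀ f → reverse (strip f) ≡ dropZ f (reverse f)
reverse-strip f = trans (cong reverse (strip-dropZ f)) (Listₚ.reverse-involutive _)

coef-reverse-top : ∀ a f → coef (reverse (a ∷ f)) (length f) ≡ a
coef-reverse-top a f rewrite Listₚ.unfold-reverse a f | sym (Listₚ.length-reverse f) = last (reverse f)
  where
  last : ∀ g → coef (g ++ [ a ]) (length g) ≡ a
  last []      = refl
  last (b ∷ g) = last g

-- `divMonic` discards the head of the reversed divisor without looking at it. For a monic divisor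
-- that head is the leading 1, and what remains has exactly as many entries as the degree.
reverse-strip-monic : ∀ {d g} → Monic d g →
                      ∃ λ bs → reverse (strip g) ≡ 1ℤ ∷ bs × length bs ≡ d
reverse-strip-monic {d} {g} mg with dropZ-head g (reverse g)
... | inj₁ empty with () ← trans (sym (mg .lead))
                             (trans (sym (strip-≈ g .at d))
                                    (cong (λ f → coef f d) (trans (strip-dropZ g) (cong reverse empty))))
... | inj₂ (c , bs , eq , c≢0) = bs , trans (reverse-strip g) (trans eq (cong (_∷ bs) c≡1)) , len≡d
  where
  g≈ : reverse (c ∷ bs) ≈ g
  g≈ = subst (_≈ g) (trans (strip-dropZ g) (cong reverse eq)) (strip-≈ g)
  top : coef g (length bs) ≡ c
  top = trans (sym (g≈ .at (length bs))) (coef-reverse-top c bs)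
  higher : Deg< (suc (length bs)) g
  higher = Deg<-≈ g≈ (subst (λ n → Deg< n (reverse (c ∷ bs))) (Listₚ.length-reverse (c ∷ bs))
                           (Deg<-length (reverse (c ∷ bs))))
  len≡d : length bs ≡ d
  len≡d with ℕₚ.<-cmp (length bs) d
  ... | tri≈ _ e _ = e
  ... | tri< l<d _ _ with () ← trans (sym (mg .lead)) (higher .above d l<d)
  ... | tri> _ _ d<l = contradiction (trans (sym top) (mg .deg .above _ d<l)) c≢0
  c≡1 : c ≡ 1ℤ
  c≡1 = trans (sym top) (trans (cong (coef g) len≡d) (mg .lead))

module _ (f₀ g₀ : Poly) (bs : List ℤ) where

  private
    d    = length bs
    quot = longDivision f₀ g₀ 1ℤ bs

  length-· : ∀ c → length (c · bs) ≡ d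
  length-· c = Listₚ.length-map (c ℤ.*_) bs

  length-step : ∀ k c r → length r ≡ k + d → length (sub (c · bs) r) ≡ k + d
  length-step k c r p =
    trans (length-sub (c · bs) r k (trans p (cong (k ℕ.+_) (sym (length-· c))))) p

  length-longDivision : ∀ k r → length r ≡ k + d → length (quot k r) ≡ k
  length-longDivision zero    r       p = refl
  length-longDivision (suc k) (c ∷ r) p = cong suc
    (length-longDivision k (sub (c · bs) r) (length-step k c r (ℕₚ.suc-injective p)))

  -- The invariant is that with `k` quotient coefficients still to come the current dividend has k +
  -- d entries. At k = 0 only `d` entries are left, and they form the remainder.
  longDivision-correct : ∀ k r → length r ≡ k + d → ∃ λ s →
    reverse r ≈ reverse (1ℤ ∷ bs) ⊗ reverse (quot k r) ⊕ s × Deg< d s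
  longDivision-correct zero r p = reverse r , ≈-sym (⊕-cong (⊗-zeroʳ (reverse (1ℤ ∷ bs))) ≈-refl) ,
    subst (λ n → Deg< n (reverse r)) (trans (Listₚ.length-reverse r) p) (Deg<-length (reverse r))
  longDivision-correct (suc k) (c ∷ r) p
    with longDivision-correct k (sub (c · bs) r) (length-step k c r (ℕₚ.suc-injective p))
  ... | s , eq , ds = s , step , ds
    where
    open ≈-Reasoning
    p′ : length r ≡ k + d
    p′ = ℕₚ.suc-injective p
    r′ = sub (c · bs) r
    B = reverse bs
    Q = reverse (quot k r′)
    B′ : reverse (1ℤ ∷ bs) ≈ B ⊕ X^ d ⊗ one
    B′ = reverse-∷ 1ℤ bs
    reverse-· : reverse (c · bs) ≈ const c ⊗ B
    reverse-· = subst (_≈ const c ⊗ B) (Listₚ.reverse-map (c ℤ.*_) bs) (≈-sym (const-⊗ c B))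
    rearrange : ∀ b y q s xk c → (((b ⊕ y ⊗ one) ⊗ q ⊕ s) ⊕ xk ⊗ (c ⊗ b)) ⊕ (xk ⊗ y) ⊗ c
                ≈ (b ⊕ y ⊗ one) ⊗ (q ⊕ xk ⊗ c) ⊕ s
    rearrange = Ring.solve-∀ solverRing
    step : reverse (c ∷ r) ≈ reverse (1ℤ ∷ bs) ⊗ reverse (c ∷ quot k r′) ⊕ s
    step = begin
      reverse (c ∷ r)
        ≈⟨ reverse-∷ c r ⟩
      reverse r ⊕ X^ length r ⊗ const c
        ≈⟨ ⊕-cong (reverse-sub (c · bs) r k (trans p′ (cong (k ℕ.+_) (sym (length-· c)))))
             (⊗-cong (subst (λ n → X^ n ≈ X^ k ⊗ X^ d) (sym p′) (X^-+ k d)) ≈-refl) ⟩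
      (reverse r′ ⊕ X^ k ⊗ reverse (c · bs)) ⊕ (X^ k ⊗ X^ d) ⊗ const c
        ≈⟨ ⊕-cong (⊕-cong (≈-trans eq (⊕-cong (⊗-cong B′ (≈-refl {Q})) (≈-refl {s})))
                          (⊗-congʳ (X^ k) reverse-·)) ≈-refl ⟩
      (((B ⊕ X^ d ⊗ one) ⊗ Q ⊕ s) ⊕ X^ k ⊗ (const c ⊗ B)) ⊕ (X^ k ⊗ X^ d) ⊗ const c
        ≈⟨ rearrange B (X^ d) Q s (X^ k) (const c) ⟩
      (B ⊕ X^ d ⊗ one) ⊗ (Q ⊕ X^ k ⊗ const c) ⊕ s
        ≈⟨ ⊕-cong (⊗-cong (≈-sym B′)
             (subst (λ n → Q ⊕ X^ n ⊗ const c ≈ reverse (c ∷ quot k r′))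
                (length-longDivision k r′ (length-step k c r p′)) (≈-sym (reverse-∷ c (quot k r′)))))
             (≈-refl {s}) ⟩
      reverse (1ℤ ∷ bs) ⊗ reverse (c ∷ quot k r′) ⊕ s ∎

divMonic-exact : ∀ {d f g q} → Monic d g → f ≈ g ⊗ q → divMonic f g ≈ q
divMonic-exact {d} {f} {g} {q} mg f≈gq with reverse-strip-monic mg
... | bs , eq , refl = subst (_≈ q) (sym divMonic≡) (≈-sym main)
  where
  r = reverse (strip f)
  k = suc (length r) ∸ suc (length bs)
  quot = longDivision f g 1ℤ bs
  divMonic≡ : divMonic f g ≡ reverse (quot k r)
  divMonic≡ = trans (divMonic-divReversed f g)
    (trans (cong (divReversed f g) eq)
           (cong (λ z → reverse (quot (suc (length r) ∸ length z) r)) eq))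
  f≈ : reverse r ≈ f
  f≈ = subst (_≈ f) (sym (Listₚ.reverse-involutive (strip f))) (strip-≈ f)
  g≈ : reverse (1ℤ ∷ bs) ≈ g
  g≈ = subst (_≈ g) (trans (sym (Listₚ.reverse-involutive (strip g))) (cong reverse eq)) (strip-≈ g)
  main : q ≈ reverse (quot k r)
  main with ℕₚ.≤-total (length bs) (length r)
  ... | inj₁ d≤r with longDivision-correct f g bs k r (sym (ℕₚ.m∸n+n≡m d≤r))
  ...   | s , e , ds = quotient-unique mg f≈gq
            (≈-trans (≈-sym f≈) (≈-trans e (⊕-cong (⊗-cong g≈ (≈-refl {reverse (quot k r)})) ≈-refl))) ds
  -- The loop runs zero times: `f` has degree below `d`, so it is its own remainder and `q` must be
  -- 0.
  main | inj₂ r≤d = subst (λ k → q ≈ reverse (quot k r)) (sym (ℕₚ.m≤n⇒m∸n≡0 r≤d))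
    (quotient-unique {r = f} mg f≈gq (≈-sym (⊕-cong (⊗-zeroʳ g) ≈-refl))
       (Deg<-≈ f≈ (Deg<-mono r≤d
         (subst (λ n → Deg< n (reverse r)) (Listₚ.length-reverse r) (Deg<-length (reverse r))))))

if-true : ∀ {a p} {A : Set a} {P : Set p} (P? : Dec P) → P → {x y : A} → (if does P? then x else y) ≡ x
if-true P? p rewrite dec-true P? p = refl

if-false : ∀ {a p} {A : Set a} {P : Set p} (P? : Dec P) → ¬ P → {x y : A} → (if does P? then x else y) ≡ y
if-false P? ¬p rewrite dec-false P? ¬p = refl

∤⇒coprime : ∀ {p k} → Prime p → p ∤ k → Coprime k p
∤⇒coprime {p} {k} pr p∤k {d} (d∣k , d∣p) with prime⇒irreducible pr d∣p
... | inj₁ d≡1  = d≡1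
... | inj₂ refl = contradiction d∣k p∤k

gcd-scale : ∀ g j e → gcd (j * g) (g * e) ≡ g * gcd j e
gcd-scale g j e = trans (cong (λ x → gcd x (g * e)) (ℕₚ.*-comm j g)) (sym (c*gcd[m,n]≡gcd[cm,cn] g j e))

-- Iterated operations over 1, …, n and over divisors

-- Instantiated with sums in ℕ and with products in ℤ[x]. The common indexing makes the degree of a
-- product of cyclotomic polynomials the corresponding sum of totients, term by term.
module BigOp {c ℓ} (M : CommutativeMonoid c ℓ) where

  open CommutativeMonoid M renaming (Carrier to C; _≈_ to _≋_; refl to ≋-refl; sym to ≋-sym; trans to ≋-trans; reflexive to ≋-reflexive)
  open import Relation.Binary.Reasoning.Setoid setoid
  open import Algebra.Properties.CommutativeSemigroup commutativeSemigroup using (interchange)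

  big : (ℕ → C) → ℕ → C
  big f zero    = ε
  big f (suc n) = f (suc n) ∙ big f n

  big-cong : ∀ {f g} n → (∀ k → 0 < k → k ≤ n → f k ≋ g k) → big f n ≋ big g n
  big-cong zero    f≋g = ≋-refl
  big-cong (suc n) f≋g = ∙-cong (f≋g (suc n) (s≤s z≤n) ℕₚ.≤-refl)
    (big-cong n λ k 0<k k≤n → f≋g k 0<k (ℕₚ.m≤n⇒m≤1+n k≤n))

  big-∙ : ∀ f g n → big (λ k → f k ∙ g k) n ≋ big f n ∙ big g n
  big-∙ f g zero    = ≋-sym (identityˡ ε)
  big-∙ f g (suc n) = ≋-trans (∙-congˡ (big-∙ f g n)) (interchange (f (suc n)) (g (suc n)) (big f n) (big g n))

  big-trim : ∀ {f m} n → m ≤ n → (∀ k → m < k → k ≤ n → f k ≋ ε) → big f n ≋ big f m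
  big-trim {m = zero}  zero    _   _   = ≋-refl
  big-trim {f} {m} (suc n) m≤1+n f≋ε with ℕₚ.m≤n⇒m<n∨m≡n m≤1+n
  ... | inj₂ refl      = ≋-refl
  ... | inj₁ (s≤s m≤n) = begin
    f (suc n) ∙ big f n  ≈⟨ ∙-cong (f≋ε (suc n) (s≤s m≤n) ℕₚ.≤-refl)
                              (big-trim n m≤n λ k m<k k≤n → f≋ε k m<k (ℕₚ.m≤n⇒m≤1+n k≤n)) ⟩
    ε ∙ big f m          ≈⟨ identityˡ _ ⟩
    big f m              ∎

  big-ε : ∀ {f} n → (∀ k → 0 < k → k ≤ n → f k ≋ ε) → big f n ≋ ε
  big-ε n = big-trim n z≤n

  big-single : ∀ {f} n e → 0 < e → e ≤ n → (∀ k → k ≢ e → f k ≋ ε) → big f n ≋ f e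
  big-single {f} n (suc e) _ e≤n f≋ε = begin
    big f n              ≈⟨ big-trim n e≤n (λ k e<k _ → f≋ε k (ℕₚ.>⇒≢ e<k)) ⟩
    f (suc e) ∙ big f e  ≈⟨ ∙-congˡ (big-ε e (λ k _ k≤e → f≋ε k (ℕₚ.<⇒≢ (s≤s k≤e)))) ⟩
    f (suc e) ∙ ε        ≈⟨ identityʳ _ ⟩
    f (suc e)            ∎

  big-swap : ∀ (f : ℕ → ℕ → C) m n → big (λ i → big (f i) n) m ≋ big (λ j → big (λ i → f i j) m) n
  big-swap f zero    n = ≋-sym (big-ε n (λ _ _ _ → ≋-refl))
  big-swap f (suc m) n = ≋-trans (∙-congˡ (big-swap f m n))
    (≋-sym (big-∙ (f (suc m)) (λ j → big (λ i → f i j) m) n))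

  big-multiples : ∀ {f} p .{{_ : ℕ.NonZero p}} n → (∀ k → p ∤ k → f k ≋ ε) →
                  big f (n * p) ≋ big (λ j → f (j * p)) n
  big-multiples p zero f≋ε = ≋-refl
  big-multiples {f} p@(suc p′) (suc n) f≋ε = ∙-congˡ (≋-trans
    (big-trim (p′ + n * p) (ℕₚ.m≤n+m (n * p) p′) λ k np<k k≤p′+np → f≋ε k λ where
      (divides j refl) → ℕₚ.<-irrefl refl (ℕₚ.<-≤-trans (ℕₚ.*-cancelʳ-< p n j np<k)
                           (ℕₚ.≤-pred (ℕₚ.*-cancelʳ-< p j (suc n) (s≤s k≤p′+np)))))
    (big-multiples p n f≋ε))

  infix 9 _when_∣_
  _when_∣_ : (ℕ → C) → ℕ → ℕ → C
  F when k ∣ n = if does (k ∣? n) then F k else ε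

  overDivisors : (ℕ → C) → ℕ → C
  overDivisors F n = big (λ k → F when k ∣ n) n

  overDivisors-suc : ∀ F n → overDivisors F (suc n) ≋ F (suc n) ∙ big (λ k → F when k ∣ suc n) n
  overDivisors-suc F n = ∙-congʳ (≋-reflexive (if-true (suc n ∣? suc n) ∣-refl))

  overDivisors-∙ : ∀ F G n → overDivisors (λ k → F k ∙ G k) n ≋ overDivisors F n ∙ overDivisors G n
  overDivisors-∙ F G n = ≋-trans (big-cong n λ k _ _ → distribute (does (k ∣? n)))
                                 (big-∙ (λ k → F when k ∣ n) (λ k → G when k ∣ n) n)
    where
    distribute : ∀ b {x y} → (if b then x ∙ y else ε) ≋ (if b then x else ε) ∙ (if b then y else ε)
    distribute true  = ≋-refl
    distribute false = ≋-sym (identityˡ ε)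

  overDivisors-trim : ∀ F d .{{_ : ℕ.NonZero d}} n → d ≤ n → big (λ k → F when k ∣ d) n ≋ overDivisors F d
  overDivisors-trim F d n d≤n =
    big-trim n d≤n λ k d<k _ → ≋-reflexive (if-false (k ∣? d) (>⇒∤ d<k))

  outside : (ℕ → C) → ℕ → ℕ → ℕ → C
  outside F d n k = if does (k ∣? d) then ε else F when k ∣ n

  -- The range `N` is independent of `n`: it is taken as `n` for a product over all divisors, and as
  -- the predecessor of `n` to leave out the factor of index `n` itself.
  big-split : ∀ F {d n} .{{_ : ℕ.NonZero d}} N → d ∣ n → d ≤ N →
              big (λ k → F when k ∣ n) N ≋ overDivisors F d ∙ big (outside F d n) N
  big-split F {d} {n} N d∣n d≤N = begin
    big (λ k → F when k ∣ n) N                             ≈⟨ big-cong N (λ k _ _ → split k) ⟩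
    big (λ k → F when k ∣ d ∙ outside F d n k) N           ≈⟨ big-∙ (λ k → F when k ∣ d) (outside F d n) N ⟩
    big (λ k → F when k ∣ d) N ∙ big (outside F d n) N     ≈⟨ ∙-congʳ (overDivisors-trim F d N d≤N) ⟩
    overDivisors F d ∙ big (outside F d n) N               ∎
    where
    split : ∀ k → F when k ∣ n ≋ F when k ∣ d ∙ outside F d n k
    split k = cases (k ∣? d)
      where
      cases : (k∣?d : Dec (k ∣ d)) →
              F when k ∣ n ≋ (if does k∣?d then F k else ε) ∙ (if does k∣?d then ε else F when k ∣ n)
      cases (yes k∣d) = ≋-trans (≋-reflexive (if-true (k ∣? n) (∣-trans k∣d d∣n))) (≋-sym (identityʳ _))
      cases (no  _)   = ≋-sym (identityˡ _)

  -- By Euclid's lemma a divisor of m p that is prime to `p` divides `m`; the others are the j p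
  -- with j | m. No divisor is counted twice, since p ∤ m.
  overDivisors-*-prime : ∀ F m p .{{_ : ℕ.NonZero m}} → Prime p → p ∤ m →
    overDivisors F (m * p) ≋ overDivisors F m ∙ overDivisors (λ j → F (j * p)) m
  overDivisors-*-prime F m p pr p∤m = begin
    overDivisors F (m * p)
      ≈⟨ big-split F (m * p) (m∣m*n p) (ℕₚ.m≤m*n m p) ⟩
    overDivisors F m ∙ big (outside F m (m * p)) (m * p)
      ≈⟨ ∙-congˡ (big-multiples p m off-multiples) ⟩
    overDivisors F m ∙ big (λ j → outside F m (m * p) (j * p)) m
      ≈⟨ ∙-congˡ (big-cong m λ j _ _ → on-multiples j) ⟩
    overDivisors F m ∙ overDivisors (λ j → F (j * p)) m ∎
    where
    instance
      p≢0 : ℕ.NonZero p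
      p≢0 = prime⇒nonZero pr
    off-multiples : ∀ k → p ∤ k → outside F m (m * p) k ≋ ε
    off-multiples k p∤k = cases (k ∣? m)
      where
      cases : (k∣?m : Dec (k ∣ m)) → (if does k∣?m then ε else F when k ∣ (m * p)) ≋ ε
      cases (yes _)   = ≋-refl
      cases (no  k∤m) = ≋-reflexive (if-false (k ∣? (m * p)) λ k∣mp →
        k∤m (coprime-divisor (∤⇒coprime pr p∤k) (subst (k ∣_) (ℕₚ.*-comm m p) k∣mp)))
    on-multiples : ∀ j → outside F m (m * p) (j * p) ≋ (λ i → F (i * p)) when j ∣ m
    on-multiples j = ≋-trans
      (≋-reflexive (if-false ((j * p) ∣? m) (p∤m ∘ m*n∣⇒n∣ j p)))
      (cases (j ∣? m))
      where
      cases : (j∣?m : Dec (j ∣ m)) → F when (j * p) ∣ (m * p) ≋ (if does j∣?m then F (j * p) else ε)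
      cases (yes j∣m) = ≋-reflexive (if-true ((j * p) ∣? (m * p)) (*-monoˡ-∣ p j∣m))
      cases (no  j∤m) = ≋-reflexive (if-false ((j * p) ∣? (m * p)) (j∤m ∘ *-cancelʳ-∣ p))

module Σℕ = BigOp ℕₚ.+-0-commutativeMonoid
open Σℕ using () renaming (big to sum₁; overDivisors to Σ∣)

-- Gauss's totient sum

coprimeIndicator : ℕ → ℕ → ℕ
coprimeIndicator n k = if does (gcd k n ℕ.≟ 1) then 1 else 0

φ-sum : ∀ n → φ n ≡ sum₁ (coprimeIndicator n) n
φ-sum n = count n
  where
  P? = λ k → gcd k n ℕ.≟ 1
  open ≡-Reasoning
  last : ∀ k → length (filter P? [ k ]) ≡ coprimeIndicator n k
  last k with does (P? k)
  ... | true  = refl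
  ... | false = refl
  count : ∀ N → length (filter P? (map suc (upTo N))) ≡ sum₁ (coprimeIndicator n) N
  count zero    = refl
  count (suc N) = begin
    length (filter P? (map suc (upTo (suc N))))
      ≡⟨ cong (length ∘ filter P? ∘ map suc) (Listₚ.upTo-∷ʳ N) ⟨
    length (filter P? (map suc (upTo N ++ [ N ])))
      ≡⟨ cong (length ∘ filter P?) (Listₚ.map-++ suc (upTo N) [ N ]) ⟩
    length (filter P? (map suc (upTo N) ++ [ suc N ]))
      ≡⟨ cong length (Listₚ.filter-++ P? (map suc (upTo N)) [ suc N ]) ⟩
    length (filter P? (map suc (upTo N)) ++ filter P? [ suc N ])
      ≡⟨ Listₚ.length-++ (filter P? (map suc (upTo N))) ⟩
    length (filter P? (map suc (upTo N))) + length (filter P? [ suc N ])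
      ≡⟨ ℕₚ.+-comm _ (length (filter P? [ suc N ])) ⟩
    length (filter P? [ suc N ]) + length (filter P? (map suc (upTo N)))
      ≡⟨ cong₂ _+_ (last (suc N)) (count N) ⟩
    coprimeIndicator n (suc N) + sum₁ (coprimeIndicator n) N ∎

sum₁-ones : ∀ n → sum₁ (λ _ → 1) n ≡ n
sum₁-ones zero    = refl
sum₁-ones (suc n) = cong suc (sum₁-ones n)

0<φ : ∀ n → 0 < n → 0 < φ n
0<φ n 0<n rewrite φ-sum n = positive n 0<n
  where
  positive : ∀ N → 0 < N → 0 < sum₁ (coprimeIndicator n) N
  positive (suc zero)    _ rewrite if-true (gcd 1 n ℕ.≟ 1) (gcd-zeroˡ n) {1} {0} = s≤s z≤n
  positive (suc (suc N)) _ = ℕₚ.<-≤-trans (positive (suc N) (s≤s z≤n)) (ℕₚ.m≤n+m _ (coprimeIndicator n (suc (suc N))))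

φ≤ : ∀ n → φ n ≤ n
φ≤ n = ℕₚ.≤-trans (Listₚ.length-filter (λ k → gcd k n ℕ.≟ 1) (map suc (upTo n)))
  (ℕₚ.≤-reflexive (trans (Listₚ.length-map suc (upTo n)) (Listₚ.length-upTo n)))

-- Sort k ∈ {1, …, n} by the value of n / gcd k n.
Σ∣-φ : ∀ n {{_ : ℕ.NonZero n}} → Σ∣ φ n ≡ n
Σ∣-φ n = begin
  Σ∣ φ n                              ≡⟨ Σℕ.big-cong n (λ e _ _ → φ-level e) ⟩
  sum₁ (λ e → sum₁ (level e) n) n     ≡⟨ Σℕ.big-swap level n n ⟩
  sum₁ (λ k → sum₁ (λ e → level e k) n) n ≡⟨ Σℕ.big-cong n (λ k _ _ → unique-level k) ⟩
  sum₁ (λ _ → 1) n                    ≡⟨ sum₁-ones n ⟩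
  n                                   ∎
  where
  open ≡-Reasoning
  level : ℕ → ℕ → ℕ
  level e k = if does (gcd k n * e ℕ.≟ n) then 1 else 0

  indicator : ∀ g e .{{_ : ℕ.NonZero e}} .{{_ : ℕ.NonZero g}} → n ≡ g * e → ∀ j →
              level e (j * g) ≡ coprimeIndicator e j
  indicator g e refl j = cong (λ b → if b then 1 else 0)
    (does-⇔ (mk⇔ to from) (gcd (j * g) (g * e) * e ℕ.≟ g * e) (gcd j e ℕ.≟ 1))
    where
    to : gcd (j * g) (g * e) * e ≡ g * e → gcd j e ≡ 1
    to eq = ℕₚ.*-cancelˡ-≡ _ 1 g (trans (sym (gcd-scale g j e))
              (trans (ℕₚ.*-cancelʳ-≡ _ g e eq) (sym (ℕₚ.*-identityʳ g))))
    from : gcd j e ≡ 1 → gcd (j * g) (g * e) * e ≡ g * e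
    from c = cong (_* e) (trans (gcd-scale g j e) (trans (cong (g *_) c) (ℕₚ.*-identityʳ g)))

  -- Write n = g e. The `k` at level `e` are those with gcd `g`, that is k = j g with j ≤ e and `j`
  -- prime to `e`.
  φ-level : ∀ e → φ Σℕ.when e ∣ n ≡ sum₁ (level e) n
  φ-level e = cases (e ∣? n)
    where
    off : ∀ g .{{_ : ℕ.NonZero e}} → n ≡ g * e → ∀ k → g ∤ k → level e k ≡ 0
    off g n≡ge k g∤k = if-false (gcd k n * e ℕ.≟ n) λ eq →
      g∤k (subst (_∣ k) (ℕₚ.*-cancelʳ-≡ (gcd k n) g e (trans eq n≡ge)) (gcd[m,n]∣m k n))
    cases : Dec (e ∣ n) → φ Σℕ.when e ∣ n ≡ sum₁ (level e) n
    cases (no e∤n) = trans (if-false (e ∣? n) e∤n) $ sym $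
      Σℕ.big-ε n λ k _ _ → if-false (gcd k n * e ℕ.≟ n) λ eq → e∤n (divides (gcd k n) (sym eq))
    cases (yes e∣n@(divides g n≡ge)) = begin
      φ Σℕ.when e ∣ n                          ≡⟨ if-true (e ∣? n) e∣n ⟩
      φ e                                      ≡⟨ φ-sum e ⟩
      sum₁ (coprimeIndicator e) e              ≡⟨ Σℕ.big-cong e (λ j _ _ → indicator g e n≡ge j) ⟨
      sum₁ (λ j → level e (j * g)) e           ≡⟨ Σℕ.big-multiples g e (off g n≡ge) ⟨
      sum₁ (level e) (e * g)                   ≡⟨ cong (sum₁ (level e)) (trans (ℕₚ.*-comm e g) (sym n≡ge)) ⟩
      sum₁ (level e) n                         ∎
      where
      instance
        ge≢0 : ℕ.NonZero (g * e)
        ge≢0 = subst ℕ.NonZero n≡ge it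
        g≢0 : ℕ.NonZero g
        g≢0 = ℕₚ.m*n≢0⇒m≢0 g {e}
        e≢0 : ℕ.NonZero e
        e≢0 = ℕₚ.m*n≢0⇒n≢0 g {e}

  unique-level : ∀ k → sum₁ (λ e → level e k) n ≡ 1
  unique-level k with gcd[m,n]∣n k n
  ... | divides e n≡e*gcd = begin
    sum₁ (λ e → level e k) n   ≡⟨ Σℕ.big-single n e (ℕ.>-nonZero⁻¹ e) (∣⇒≤ (divides (gcd k n) n≡gcd*e))
                                    (λ e′ e′≢e → if-false (gcd k n * e′ ℕ.≟ n)
                                      λ eq → e′≢e (ℕₚ.*-cancelˡ-≡ e′ e (gcd k n) (trans eq n≡gcd*e))) ⟩
    level e k                  ≡⟨ if-true (gcd k n * e ℕ.≟ n) (sym n≡gcd*e) ⟩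
    1                          ∎
    where
    n≡gcd*e : n ≡ gcd k n * e
    n≡gcd*e = trans n≡e*gcd (ℕₚ.*-comm e (gcd k n))
    instance
      eg≢0 : ℕ.NonZero (e * gcd k n)
      eg≢0 = subst ℕ.NonZero n≡e*gcd it
      g≢0 : ℕ.NonZero (gcd k n)
      g≢0 = ℕₚ.m*n≢0⇒n≢0 e
      e≢0 : ℕ.NonZero e
      e≢0 = ℕₚ.m*n≢0⇒m≢0 e {gcd k n}

module Πₚ = BigOp (CommutativeRing.*-commutativeMonoid ℤ[x])
open Πₚ using () renaming (big to prod₁; overDivisors to Π∣)

-- Divisibility among the polynomials xⁿ - 1

xⁿ-1-+ : ∀ m n → xⁿ-1 (m + n) ≈ X^ m ⊗ xⁿ-1 n ⊕ xⁿ-1 m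
xⁿ-1-+ m n = begin
  xⁿ-1 (m + n)                                ≈⟨ xⁿ-1≈ (m + n) ⟩
  X^ (m + n) ⊕ ⊝ one                          ≈⟨ ⊕-cong (X^-+ m n) ≈-refl ⟩
  X^ m ⊗ X^ n ⊕ ⊝ one                         ≈⟨ telescope (X^ m) (X^ n) ⟩
  X^ m ⊗ (X^ n ⊕ ⊝ one) ⊕ (X^ m ⊕ ⊝ one)      ≈⟨ ⊕-cong (⊗-congʳ (X^ m) (xⁿ-1≈ n)) (xⁿ-1≈ m) ⟨
  X^ m ⊗ xⁿ-1 n ⊕ xⁿ-1 m                      ∎
  where
  open ≈-Reasoning
  telescope : ∀ x y → x ⊗ y ⊕ ⊝ one ≈ x ⊗ (y ⊕ ⊝ one) ⊕ (x ⊕ ⊝ one)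
  telescope = Ring.solve-∀ solverRing

geometric : ℕ → ℕ → Poly
geometric d zero    = []
geometric d (suc q) = one ⊕ X^ d ⊗ geometric d q

xⁿ-1-* : ∀ d q → xⁿ-1 (q * d) ≈ xⁿ-1 d ⊗ geometric d q
xⁿ-1-* d zero    = ≈-sym (⊗-zeroʳ (xⁿ-1 d))
xⁿ-1-* d (suc q) = begin
  xⁿ-1 (d + q * d)                                  ≈⟨ xⁿ-1-+ d (q * d) ⟩
  X^ d ⊗ xⁿ-1 (q * d) ⊕ xⁿ-1 d                      ≈⟨ ⊕-cong (⊗-congʳ (X^ d) (xⁿ-1-* d q)) ≈-refl ⟩
  X^ d ⊗ (xⁿ-1 d ⊗ geometric d q) ⊕ xⁿ-1 d          ≈⟨ factor (X^ d) (xⁿ-1 d) (geometric d q) ⟩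
  xⁿ-1 d ⊗ (one ⊕ X^ d ⊗ geometric d q)             ∎
  where
  open ≈-Reasoning
  factor : ∀ x u s → x ⊗ (u ⊗ s) ⊕ u ≈ u ⊗ (one ⊕ x ⊗ s)
  factor = Ring.solve-∀ solverRing

-- Modulo x^d - 1 each of the `q` summands x^(i d) is 1.
geometric-residue : ∀ d q → ∃ λ w → geometric d q ≈ const (+ q) ⊕ xⁿ-1 d ⊗ w
geometric-residue d zero    = [] , ≈-trans (≈-sym shift-zero)
  (≈-trans (≈-sym (⊕-identityʳ (const 0ℤ))) (⊕-cong (≈-refl {const 0ℤ}) (≈-sym (⊗-zeroʳ (xⁿ-1 d)))))
geometric-residue d (suc q) with geometric-residue d q
... | w , S≈ = const (+ q) ⊕ (xⁿ-1 d ⊕ one) ⊗ w , (begin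
  one ⊕ X^ d ⊗ geometric d q
    ≈⟨ ⊕-cong (≈-refl {one}) (⊗-cong X^d≈ S≈) ⟩
  one ⊕ (xⁿ-1 d ⊕ one) ⊗ (const (+ q) ⊕ xⁿ-1 d ⊗ w)
    ≈⟨ residue (xⁿ-1 d) (const (+ q)) w ⟩
  (one ⊕ const (+ q)) ⊕ xⁿ-1 d ⊗ (const (+ q) ⊕ (xⁿ-1 d ⊕ one) ⊗ w) ∎)
  where
  open ≈-Reasoning
  residue : ∀ u c w → one ⊕ (u ⊕ one) ⊗ (c ⊕ u ⊗ w) ≈ (one ⊕ c) ⊕ u ⊗ (c ⊕ (u ⊕ one) ⊗ w)
  residue = Ring.solve-∀ solverRing
  add-sub : ∀ x → x ≈ (x ⊕ ⊝ one) ⊕ one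
  add-sub = Ring.solve-∀ solverRing
  X^d≈ : X^ d ≈ xⁿ-1 d ⊕ one
  X^d≈ = ≈-trans (add-sub (X^ d)) (⊕-cong (≈-sym (xⁿ-1≈ d)) ≈-refl)

∣ₚ-trans : ∀ {f g h} → f ∣ₚ g → g ∣ₚ h → f ∣ₚ h
∣ₚ-trans {f} {g} {h} (dividesₚ k g≈fk) (dividesₚ l h≈gl) =
  dividesₚ (k ⊗ l) $ ≈-trans h≈gl (≈-trans (⊗-cong g≈fk (≈-refl {l})) (⊗-assoc f k l))

∣ₚ-⊗ʳ : ∀ {f g} h → f ∣ₚ g → f ∣ₚ g ⊗ h
∣ₚ-⊗ʳ {f} {g} h f∣g = ∣ₚ-trans f∣g (dividesₚ h ≈-refl)

∣ₚ-≈ʳ : ∀ {f g h} → g ≈ h → f ∣ₚ g → f ∣ₚ h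
∣ₚ-≈ʳ g≈h (dividesₚ k g≈fk) = dividesₚ k $ ≈-trans (≈-sym g≈h) g≈fk

∣ₚ-⊕ : ∀ {f g h} → f ∣ₚ g → f ∣ₚ h → f ∣ₚ g ⊕ h
∣ₚ-⊕ {f} (dividesₚ k g≈fk) (dividesₚ l h≈fl) =
  dividesₚ (k ⊕ l) $ ≈-trans (⊕-cong g≈fk h≈fl) (≈-sym (⊗-distribˡ-⊕ f k l))

∣ₚ-⊝ : ∀ {f g} → f ∣ₚ g → f ∣ₚ ⊝ g
∣ₚ-⊝ {f} (dividesₚ k g≈fk) = dividesₚ (⊝ k) $ ≈-trans (⊝-cong g≈fk) (neg f k)
  where
  neg : ∀ f k → ⊝ (f ⊗ k) ≈ f ⊗ ⊝ k
  neg = Ring.solve-∀ solverRing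

∣⇒xⁿ-1∣ : ∀ {d n} → d ∣ n → xⁿ-1 d ∣ₚ xⁿ-1 n
∣⇒xⁿ-1∣ {d} (divides q refl) = dividesₚ (geometric d q) (xⁿ-1-* d q)

-- Ideals with two generators

infix 4 _∈⟨_,_⟩
record _∈⟨_,_⟩ (h f g : Poly) : Set where
  constructor combination
  field
    u v     : Poly
    h≈uf+vg : h ≈ u ⊗ f ⊕ v ⊗ g

module _ {f g : Poly} where

  ∈-≈ : ∀ {h k} → h ≈ k → h ∈⟨ f , g ⟩ → k ∈⟨ f , g ⟩
  ∈-≈ h≈k (combination u v eq) = combination u v (≈-trans (≈-sym h≈k) eq)

  ∈-⊕ : ∀ {h k} → h ∈⟨ f , g ⟩ → k ∈⟨ f , g ⟩ → h ⊕ k ∈⟨ f , g ⟩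
  ∈-⊕ (combination u v eq) (combination u′ v′ eq′) =
    combination (u ⊕ u′) (v ⊕ v′) (≈-trans (⊕-cong eq eq′) (collect u v u′ v′ f g))
    where
    collect : ∀ u v u′ v′ f g → (u ⊗ f ⊕ v ⊗ g) ⊕ (u′ ⊗ f ⊕ v′ ⊗ g) ≈ (u ⊕ u′) ⊗ f ⊕ (v ⊕ v′) ⊗ g
    collect = Ring.solve-∀ solverRing

  ∈-⊗ : ∀ {h} k → h ∈⟨ f , g ⟩ → h ⊗ k ∈⟨ f , g ⟩
  ∈-⊗ k (combination u v eq) =
    combination (u ⊗ k) (v ⊗ k) (≈-trans (⊗-cong eq (≈-refl {k})) (collect u v k f g))
    where
    collect : ∀ u v k f g → (u ⊗ f ⊕ v ⊗ g) ⊗ k ≈ (u ⊗ k) ⊗ f ⊕ (v ⊗ k) ⊗ g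
    collect = Ring.solve-∀ solverRing

  ∈-∣ : ∀ {h k} → h ∈⟨ f , g ⟩ → h ∣ₚ k → k ∈⟨ f , g ⟩
  ∈-∣ h∈ (dividesₚ q k≈hq) = ∈-≈ (≈-sym k≈hq) (∈-⊗ q h∈)

  ∈-⊝ : ∀ {h} → h ∈⟨ f , g ⟩ → ⊝ h ∈⟨ f , g ⟩
  ∈-⊝ {h} h∈ = ∈-∣ h∈ (∣ₚ-⊝ (dividesₚ one (≈-sym (CommutativeRing.*-identityʳ ℤ[x] h))))

  ∈-left : f ∈⟨ f , g ⟩
  ∈-left = combination one [] (≈-sym (≈-trans (⊕-identityʳ (one ⊗ f)) (⊗-identityˡ f)))

  ∈-right : g ∈⟨ f , g ⟩
  ∈-right = combination [] one (≈-sym (⊗-identityˡ g))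

  xⁿ-1-∸∈ : ∀ d {k} → xⁿ-1 k ∈⟨ f , g ⟩ → xⁿ-1 (d + k) ∈⟨ f , g ⟩ → xⁿ-1 d ∈⟨ f , g ⟩
  xⁿ-1-∸∈ d {k} k∈ d+k∈ = ∈-≈
    (≈-trans (⊕-cong (xⁿ-1-+ d k) (⊝-cong (⊗-comm (xⁿ-1 k) (X^ d)))) (cancel (X^ d ⊗ xⁿ-1 k) (xⁿ-1 d)))
    (∈-⊕ d+k∈ (∈-⊝ (∈-⊗ (X^ d) k∈)))
    where
    cancel : ∀ s t → (s ⊕ t) ⊕ ⊝ s ≈ t
    cancel = Ring.solve-∀ solverRing

  -- Bézout over ℕ provides a multiple of `a` and a multiple of `b` that differ by the gcd, so one
  -- subtraction of exponents is enough.
  xⁿ-1-gcd∈ : ∀ a b → xⁿ-1 a ∈⟨ f , g ⟩ → xⁿ-1 b ∈⟨ f , g ⟩ → xⁿ-1 (gcd a b) ∈⟨ f , g ⟩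
  xⁿ-1-gcd∈ a b a∈ b∈ with Bézout.identity (gcd-GCD a b)
  ... | Bézout.Identity.+- x y eq = xⁿ-1-∸∈ (gcd a b) (∈-∣ b∈ (∣⇒xⁿ-1∣ (n∣m*n y)))
          (subst (λ n → xⁿ-1 n ∈⟨ f , g ⟩) (sym eq) (∈-∣ a∈ (∣⇒xⁿ-1∣ (n∣m*n x))))
  ... | Bézout.Identity.-+ x y eq = xⁿ-1-∸∈ (gcd a b) (∈-∣ a∈ (∣⇒xⁿ-1∣ (n∣m*n x)))
          (subst (λ n → xⁿ-1 n ∈⟨ f , g ⟩) (sym eq) (∈-∣ b∈ (∣⇒xⁿ-1∣ (n∣m*n y))))

-- Coprimality over ℚ, with denominators cleared.
record Coprimeₚ (f g : Poly) : Set where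
  constructor coprimeₚ
  field
    N         : ℤ
    {{N≢0}}   : ℤ.NonZero N
    N∈        : const N ∈⟨ f , g ⟩

Coprimeₚ-one : ∀ f → Coprimeₚ f one
Coprimeₚ-one f = coprimeₚ 1ℤ ∈-right

-- In the product of the two Bézout identities every term but one contains `f`, and that one
-- contains g h.
Coprimeₚ-⊗ : ∀ {f g h} → Coprimeₚ f g → Coprimeₚ f h → Coprimeₚ f (g ⊗ h)
Coprimeₚ-⊗ {f} {g} {h} (coprimeₚ M (combination u v eq)) (coprimeₚ N (combination u′ v′ eq′)) =
  coprimeₚ (M ℤ.* N) {{ℤₚ.i*j≢0 M N}}
    (combination (u ⊗ (u′ ⊗ f ⊕ v′ ⊗ h) ⊕ v ⊗ g ⊗ u′) (v ⊗ v′) (≈-trans (≈-sym (const-⊗ M (const N)))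
      (≈-trans (⊗-cong eq eq′) (collect u v u′ v′ f g h))))
  where
  collect : ∀ u v u′ v′ f g h → (u ⊗ f ⊕ v ⊗ g) ⊗ (u′ ⊗ f ⊕ v′ ⊗ h)
    ≈ (u ⊗ (u′ ⊗ f ⊕ v′ ⊗ h) ⊕ v ⊗ g ⊗ u′) ⊗ f ⊕ (v ⊗ v′) ⊗ (g ⊗ h)
  collect = Ring.solve-∀ solverRing

coprimeₚ-∣ : ∀ {d f g h} → Monic d (f ⊗ g) → Coprimeₚ f g → f ∣ₚ h → g ∣ₚ h → f ⊗ g ∣ₚ h
coprimeₚ-∣ {d} {f} {g} {h} mfg (coprimeₚ N (combination u v eq)) (dividesₚ k h≈fk) (dividesₚ l h≈gl) =
  monic-∣-cancel-const N mfg (dividesₚ (u ⊗ l ⊕ v ⊗ k) (begin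
    N · h                                ≈⟨ const-⊗ N h ⟨
    const N ⊗ h                          ≈⟨ ⊗-cong eq (≈-refl {h}) ⟩
    (u ⊗ f ⊕ v ⊗ g) ⊗ h                  ≈⟨ ⊗-distribʳ-⊕ h (u ⊗ f) (v ⊗ g) ⟩
    (u ⊗ f) ⊗ h ⊕ (v ⊗ g) ⊗ h            ≈⟨ ⊕-cong (⊗-congʳ (u ⊗ f) h≈gl) (⊗-congʳ (v ⊗ g) h≈fk) ⟩
    (u ⊗ f) ⊗ (g ⊗ l) ⊕ (v ⊗ g) ⊗ (f ⊗ k) ≈⟨ collect u v f g k l ⟩
    (f ⊗ g) ⊗ (u ⊗ l ⊕ v ⊗ k)            ∎))
  where
  open ≈-Reasoning
  collect : ∀ u v f g k l → (u ⊗ f) ⊗ (g ⊗ l) ⊕ (v ⊗ g) ⊗ (f ⊗ k) ≈ (f ⊗ g) ⊗ (u ⊗ l ⊕ v ⊗ k)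
  collect = Ring.solve-∀ solverRing

-- Cyclotomic polynomials

-- Both fields are needed as induction hypothesis: the long division that defines the next
-- polynomial is known to be correct only for a monic divisor.
record Cyclotomic (n : ℕ) : Set where
  field
    product : Π∣ Φ n ≈ xⁿ-1 n
    degree  : Monic (φ n) (Φ n)
open Cyclotomic

Φ-∣-xⁿ-1 : ∀ {n} → 0 < n → Cyclotomic n → Φ n ∣ₚ xⁿ-1 n
Φ-∣-xⁿ-1 {suc n} _ cn = dividesₚ _ $ ≈-trans (≈-sym (cn .product)) (Πₚ.overDivisors-suc Φ n)

-- In the product for x^(q d) - 1 the factors with index dividing `d` multiply to x^d - 1. Since d <
-- q d, the factor of index q d is not among them and survives the cancellation.
Φ-∣-geometric : ∀ {d} q → 0 < d → d < q * d → Cyclotomic d → Cyclotomic (q * d) →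
                Φ (q * d) ∣ₚ geometric d q
Φ-∣-geometric {d} q 0<d d<qd cd cqd = go (q * d) refl d<qd cqd
  where
  open ≈-Reasoning
  instance
    d≢0 : ℕ.NonZero d
    d≢0 = ℕ.>-nonZero 0<d
  swap : ∀ f u r → f ⊗ (u ⊗ r) ≈ u ⊗ (f ⊗ r)
  swap = Ring.solve-∀ solverRing
  -- A variable in place of q * d can be matched as a successor, which splits off the factor at the
  -- top index.
  go : ∀ a → a ≡ q * d → d < a → Cyclotomic a → Φ a ∣ₚ geometric d q
  go (suc a) eq (s≤s d≤a) ca = dividesₚ R $ ⊗-cancelˡ (Monic-xⁿ-1 d 0<d) (begin
    xⁿ-1 d ⊗ geometric d q                       ≈⟨ xⁿ-1-* d q ⟨
    xⁿ-1 (q * d)                                 ≡⟨ cong xⁿ-1 eq ⟨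
    xⁿ-1 (suc a)                                 ≈⟨ ca .product ⟨
    Π∣ Φ (suc a)                                 ≈⟨ Πₚ.overDivisors-suc Φ a ⟩
    Φ (suc a) ⊗ prod₁ (λ k → Φ Πₚ.when k ∣ suc a) a
      ≈⟨ ⊗-congʳ (Φ (suc a)) (Πₚ.big-split Φ a (divides q eq) d≤a) ⟩
    Φ (suc a) ⊗ (Π∣ Φ d ⊗ R)                     ≈⟨ ⊗-congʳ (Φ (suc a)) (⊗-cong (cd .product) (≈-refl {R})) ⟩
    Φ (suc a) ⊗ (xⁿ-1 d ⊗ R)                     ≈⟨ swap (Φ (suc a)) (xⁿ-1 d) R ⟩
    xⁿ-1 d ⊗ (Φ (suc a) ⊗ R)                     ∎)
    where R = prod₁ (Πₚ.outside Φ d (suc a)) a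

-- The ideal contains x^d - 1 for d = gcd a b, and modulo x^d - 1 the
-- multiple (x^a - 1) / (x^d - 1) of Φ a is the constant a / d.
Φ-coprime : ∀ a b → 0 < b → b < a → (∀ k → 0 < k → k ≤ a → Cyclotomic k) → Coprimeₚ (Φ a) (Φ b)
Φ-coprime a b 0<b b<a cyc with gcd[m,n]∣m a b
... | divides q a≡qd with geometric-residue (gcd a b) q
...   | w , S≈ = coprimeₚ (+ q) {{q≢0}} (∈-≈ (isolate S≈) (∈-⊕ (∈-∣ ∈-left Φ∣S) (∈-⊝ (∈-⊗ w xᵈ-1∈))))
  where
  d = gcd a b
  0<a = ℕₚ.<-trans 0<b b<a
  instance
    b≢0 : ℕ.NonZero b
    b≢0 = ℕ.>-nonZero 0<b
    qd≢0 : ℕ.NonZero (q * d)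
    qd≢0 = subst ℕ.NonZero a≡qd (ℕ.>-nonZero 0<a)
    q≢0′ : ℕ.NonZero q
    q≢0′ = ℕₚ.m*n≢0⇒m≢0 q {d}
  q≢0 : ℤ.NonZero (+ q)
  q≢0 = q≢0′
  0<d : 0 < d
  0<d = ℕ.>-nonZero⁻¹ d {{ℕₚ.m*n≢0⇒n≢0 q}}
  d≤b : d ≤ b
  d≤b = gcd[m,n]≤n a b
  d<a : d < a
  d<a = ℕₚ.≤-<-trans d≤b b<a
  Φ∣S : Φ a ∣ₚ geometric d q
  Φ∣S = subst (λ n → Φ n ∣ₚ geometric d q) (sym a≡qd)
    (Φ-∣-geometric q 0<d (subst (d <_) a≡qd d<a) (cyc d 0<d (ℕₚ.<⇒≤ d<a))
       (subst Cyclotomic a≡qd (cyc a 0<a ℕₚ.≤-refl)))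
  xᵈ-1∈ : xⁿ-1 d ∈⟨ Φ a , Φ b ⟩
  xᵈ-1∈ = xⁿ-1-gcd∈ a b
    (∈-∣ ∈-left (Φ-∣-xⁿ-1 0<a (cyc a 0<a ℕₚ.≤-refl)))
    (∈-∣ ∈-right (Φ-∣-xⁿ-1 0<b (cyc b 0<b (ℕₚ.<⇒≤ b<a))))
  isolate : ∀ {s c t} → s ≈ c ⊕ t → s ⊕ ⊝ t ≈ c
  isolate {s} {c} {t} s≈ = ≈-trans (⊕-cong s≈ ≈-refl) (cancel c t)
    where
    cancel : ∀ c t → (c ⊕ t) ⊕ ⊝ t ≈ c
    cancel = Ring.solve-∀ solverRing

-- Exactness of the recursion for Φ

prod₁-coprime : ∀ {f} (F : ℕ → Poly) n N → (∀ k → 0 < k → k ≤ N → Coprimeₚ f (F k)) →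
                Coprimeₚ f (prod₁ (λ k → F Πₚ.when k ∣ n) N)
prod₁-coprime {f} F n zero    cop = Coprimeₚ-one f
prod₁-coprime {f} F n (suc N) cop = Coprimeₚ-⊗ {g = F Πₚ.when (suc N) ∣ n} factor
  (prod₁-coprime F n N λ k 0<k k≤N → cop k 0<k (ℕₚ.m≤n⇒m≤1+n k≤N))
  where
  factor : Coprimeₚ f (F Πₚ.when (suc N) ∣ n)
  factor with does (suc N ∣? n)
  ... | true  = cop (suc N) (s≤s z≤n) ℕₚ.≤-refl
  ... | false = Coprimeₚ-one f

prod₁-monic : ∀ {δ F} n N → (∀ k → 0 < k → k ≤ N → Monic (δ k) (F k)) →
              Monic (sum₁ (λ k → δ Σℕ.when k ∣ n) N) (prod₁ (λ k → F Πₚ.when k ∣ n) N)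
prod₁-monic n zero    m = Monic-one
prod₁-monic {δ} {F} n (suc N) m = Monic-⊗ {f = F Πₚ.when (suc N) ∣ n} factor
  (prod₁-monic n N λ k 0<k k≤N → m k 0<k (ℕₚ.m≤n⇒m≤1+n k≤N))
  where
  factor : Monic (δ Σℕ.when (suc N) ∣ n) (F Πₚ.when (suc N) ∣ n)
  factor with does (suc N ∣? n)
  ... | true  = m (suc N) (s≤s z≤n) ℕₚ.≤-refl
  ... | false = Monic-one

module _ (n : ℕ) (cyc : ∀ k → 0 < k → k < n → Cyclotomic k) where

  Φ-prod₁-monic : ∀ N → N < n → Monic (sum₁ (λ k → φ Σℕ.when k ∣ n) N) (prod₁ (λ k → Φ Πₚ.when k ∣ n) N)
  Φ-prod₁-monic N N<n = prod₁-monic n N λ k 0<k k≤N → cyc k 0<k (ℕₚ.≤-<-trans k≤N N<n) .degree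

  -- Factors are added one at a time: the new one divides x^n - 1 and is coprime to each earlier
  -- one, hence to their product. Only indices below `n` occur, as strong induction requires.
  Φ-prod₁-∣ : ∀ N → N < n → prod₁ (λ k → Φ Πₚ.when k ∣ n) N ∣ₚ xⁿ-1 n
  Φ-prod₁-∣ zero    _     = dividesₚ (xⁿ-1 n) $ ≈-sym (⊗-identityˡ (xⁿ-1 n))
  Φ-prod₁-∣ (suc N) 1+N<n = cases (suc N ∣? n)
    where
    rest = prod₁ (λ k → Φ Πₚ.when k ∣ n) N
    rest∣ : rest ∣ₚ xⁿ-1 n
    rest∣ = Φ-prod₁-∣ N (ℕₚ.<⇒≤ 1+N<n)
    P : Poly → Set
    P f = f ⊗ rest ∣ₚ xⁿ-1 n
    cases : Dec (suc N ∣ n) → P (Φ Πₚ.when (suc N) ∣ n)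
    cases (no ∤n) = subst P (sym (if-false (suc N ∣? n) ∤n))
      (dividesₚ (rest∣ .quotient) $ ≈-trans (rest∣ .equality) (⊗-cong (≈-sym (⊗-identityˡ rest)) ≈-refl))
    cases (yes ∣n) = subst P (sym (if-true (suc N ∣? n) ∣n))
      (coprimeₚ-∣ (Monic-⊗ (cN .degree) (Φ-prod₁-monic N (ℕₚ.<⇒≤ 1+N<n)))
        (prod₁-coprime Φ n N λ k 0<k k≤N → Φ-coprime (suc N) k 0<k (s≤s k≤N)
          λ j 0<j j≤1+N → cyc j 0<j (ℕₚ.≤-<-trans j≤1+N 1+N<n))
        (∣ₚ-trans (Φ-∣-xⁿ-1 (s≤s z≤n) cN) (∣⇒xⁿ-1∣ ∣n))
        rest∣)
      where cN = cyc (suc N) (s≤s z≤n) 1+N<n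

-- `F` stands for the anonymous fold function inside `cycloList`; only its defining equation
-- matters.
foldr-cycloList : ∀ n (F : ℕ × Poly → Poly → Poly) →
  (∀ d f acc → F (d , f) acc ≡ (if does (d ∣? n) then f ⊗ acc else acc)) →
  ∀ N → foldr F one (cycloList N) ≈ prod₁ (λ k → Φ Πₚ.when k ∣ n) N
foldr-cycloList n F F≡ zero    = ≈-refl
foldr-cycloList n F F≡ (suc N) = begin
  F (suc N , Φ (suc N)) acc                            ≡⟨ F≡ (suc N) (Φ (suc N)) acc ⟩
  (if does (suc N ∣? n) then Φ (suc N) ⊗ acc else acc) ≈⟨ distribute (does (suc N ∣? n)) ⟩
  Φ Πₚ.when (suc N) ∣ n ⊗ acc                          ≈⟨ ⊗-congʳ (Φ Πₚ.when (suc N) ∣ n) (foldr-cycloList n F F≡ N) ⟩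
  prod₁ (λ k → Φ Πₚ.when k ∣ n) (suc N)                ∎
  where
  open ≈-Reasoning
  acc = foldr F one (cycloList N)
  distribute : ∀ b → (if b then Φ (suc N) ⊗ acc else acc) ≈ (if b then Φ (suc N) else one) ⊗ acc
  distribute true  = ≈-refl
  distribute false = ≈-sym (⊗-identityˡ acc)

cyclotomic : ∀ n → 0 < n → Cyclotomic n
cyclotomic = <-rec (λ n → 0 < n → Cyclotomic n) strong
  where
  step : ∀ n → (∀ k → 0 < k → k < suc n → Cyclotomic k) → Cyclotomic (suc n)
  step n cyc with Φ-prod₁-∣ (suc n) cyc n ℕₚ.≤-refl
  ... | dividesₚ q xⁿ-1≈Pq = record { product = prd ; degree = Monic-cancelˡ mP mPΦ }
    where
    open ≈-Reasoning
    P = prod₁ (λ k → Φ Πₚ.when k ∣ suc n) n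
    mP : Monic (sum₁ (λ k → φ Σℕ.when k ∣ suc n) n) P
    mP = Φ-prod₁-monic (suc n) cyc n ℕₚ.≤-refl
    fold≈P = foldr-cycloList (suc n) _ (λ _ _ _ → refl) n
    Φ≈q : Φ (suc n) ≈ q
    Φ≈q = divMonic-exact (Monic-≈ (≈-sym fold≈P) mP)
      (≈-trans xⁿ-1≈Pq (⊗-cong (≈-sym fold≈P) (≈-refl {q})))
    PΦ≈ : P ⊗ Φ (suc n) ≈ xⁿ-1 (suc n)
    PΦ≈ = ≈-trans (⊗-congʳ P Φ≈q) (≈-sym xⁿ-1≈Pq)
    prd : Π∣ Φ (suc n) ≈ xⁿ-1 (suc n)
    prd = ≈-trans (Πₚ.overDivisors-suc Φ n) (≈-trans (⊗-comm (Φ (suc n)) P) PΦ≈)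
    -- By the totient sum, φ(n + 1) is exactly the degree that the proper divisors leave over from
    -- x^(n+1) - 1.
    degrees : suc n ≡ sum₁ (λ k → φ Σℕ.when k ∣ suc n) n + φ (suc n)
    degrees = trans (sym (Σ∣-φ (suc n))) (trans (Σℕ.overDivisors-suc φ n) (ℕₚ.+-comm (φ (suc n)) _))
    mPΦ : Monic (sum₁ (λ k → φ Σℕ.when k ∣ suc n) n + φ (suc n)) (P ⊗ Φ (suc n))
    mPΦ = Monic-≈ (≈-sym PΦ≈)
      (subst (λ d → Monic d (xⁿ-1 (suc n))) degrees (Monic-xⁿ-1 (suc n) (s≤s z≤n)))
  strong : ∀ n → (∀ {k} → k < n → 0 < k → Cyclotomic k) → 0 < n → Cyclotomic n
  strong (suc n) rec _ = step n λ k 0<k k<1+n → rec k<1+n 0<k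

-- Substitution

infixl 8 _∘ₚ_
_∘ₚ_ : Poly → Poly → Poly
[]      ∘ₚ g = []
(a ∷ f) ∘ₚ g = const a ⊕ g ⊗ (f ∘ₚ g)

-- Equal polynomials can have lists of different lengths, so congruence of substitution comes down
-- to a list of zeros.
≈0⇒∘ₚ≈0 : ∀ f g → f ≈ [] → f ∘ₚ g ≈ []
≈0⇒∘ₚ≈0 []      g f≈0 = ≈-refl
≈0⇒∘ₚ≈0 (a ∷ f) g f≈0 = ⊕-cong
  (≈-trans (∷-cong (f≈0 .at 0) ≈-refl) shift-zero)
  (≈-trans (⊗-congʳ g (≈0⇒∘ₚ≈0 f g (coeffwise λ n → f≈0 .at (suc n)))) (⊗-zeroʳ g))

∘ₚ-congˡ : ∀ {f h} g → f ≈ h → f ∘ₚ g ≈ h ∘ₚ g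
∘ₚ-congˡ {[]}    {h}     g f≈h = ≈-sym (≈0⇒∘ₚ≈0 h g (≈-sym f≈h))
∘ₚ-congˡ {a ∷ f} {[]}    g f≈h = ≈0⇒∘ₚ≈0 (a ∷ f) g f≈h
∘ₚ-congˡ {a ∷ f} {b ∷ h} g f≈h = ⊕-cong (∷-cong (f≈h .at 0) ≈-refl)
  (⊗-congʳ g (∘ₚ-congˡ {f} {h} g (coeffwise λ n → f≈h .at (suc n))))

∘ₚ-congʳ : ∀ f {g h} → g ≈ h → f ∘ₚ g ≈ f ∘ₚ h
∘ₚ-congʳ []      g≈h = ≈-refl
∘ₚ-congʳ (a ∷ f) g≈h = ⊕-cong ≈-refl (⊗-cong g≈h (∘ₚ-congʳ f g≈h))

∘ₚ-⊕ : ∀ f h g → (f ⊕ h) ∘ₚ g ≈ f ∘ₚ g ⊕ h ∘ₚ g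
∘ₚ-⊕ []      h       g = ≈-refl
∘ₚ-⊕ (a ∷ f) []      g = ≈-sym (⊕-identityʳ ((a ∷ f) ∘ₚ g))
∘ₚ-⊕ (a ∷ f) (b ∷ h) g = ≈-trans
  (⊕-cong (≈-refl {const a ⊕ const b}) (⊗-congʳ g (∘ₚ-⊕ f h g)))
  (regroup (const a) (const b) g (f ∘ₚ g) (h ∘ₚ g))
  where
  regroup : ∀ a b g s t → (a ⊕ b) ⊕ g ⊗ (s ⊕ t) ≈ (a ⊕ g ⊗ s) ⊕ (b ⊕ g ⊗ t)
  regroup = Ring.solve-∀ solverRing

∘ₚ-· : ∀ a f g → (a · f) ∘ₚ g ≈ const a ⊗ (f ∘ₚ g)
∘ₚ-· a []      g = ≈-sym (⊗-zeroʳ (const a))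
∘ₚ-· a (b ∷ f) g = ≈-trans
  (⊕-cong (≈-sym (const-⊗ a (const b))) (⊗-congʳ g (∘ₚ-· a f g)))
  (regroup (const a) (const b) g (f ∘ₚ g))
  where
  regroup : ∀ a b g s → a ⊗ b ⊕ g ⊗ (a ⊗ s) ≈ a ⊗ (b ⊕ g ⊗ s)
  regroup = Ring.solve-∀ solverRing

∘ₚ-shift : ∀ f g → (0ℤ ∷ f) ∘ₚ g ≈ g ⊗ (f ∘ₚ g)
∘ₚ-shift f g = ⊕-cong shift-zero ≈-refl

∘ₚ-⊗ : ∀ f h g → (f ⊗ h) ∘ₚ g ≈ (f ∘ₚ g) ⊗ (h ∘ₚ g)
∘ₚ-⊗ []      h g = ≈-refl
∘ₚ-⊗ (a ∷ f) h g = begin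
  (a · h ⊕ (0ℤ ∷ f ⊗ h)) ∘ₚ g
    ≈⟨ ∘ₚ-⊕ (a · h) (0ℤ ∷ f ⊗ h) g ⟩
  (a · h) ∘ₚ g ⊕ (0ℤ ∷ f ⊗ h) ∘ₚ g
    ≈⟨ ⊕-cong (∘ₚ-· a h g) (≈-trans (∘ₚ-shift (f ⊗ h) g) (⊗-congʳ g (∘ₚ-⊗ f h g))) ⟩
  const a ⊗ (h ∘ₚ g) ⊕ g ⊗ ((f ∘ₚ g) ⊗ (h ∘ₚ g))
    ≈⟨ factor (const a) (h ∘ₚ g) g (f ∘ₚ g) ⟩
  (const a ⊕ g ⊗ (f ∘ₚ g)) ⊗ (h ∘ₚ g) ∎
  where
  open ≈-Reasoning
  factor : ∀ a h g f → a ⊗ h ⊕ g ⊗ (f ⊗ h) ≈ (a ⊕ g ⊗ f) ⊗ h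
  factor = Ring.solve-∀ solverRing

∘ₚ-const : ∀ a g → const a ∘ₚ g ≈ const a
∘ₚ-const a g = ≈-trans (⊕-cong (≈-refl {const a}) (⊗-zeroʳ g)) (⊕-identityʳ (const a))

∘ₚ-assoc : ∀ f g h → f ∘ₚ g ∘ₚ h ≈ f ∘ₚ (g ∘ₚ h)
∘ₚ-assoc []      g h = ≈-refl
∘ₚ-assoc (a ∷ f) g h = ≈-trans (∘ₚ-⊕ (const a) (g ⊗ (f ∘ₚ g)) h)
  (⊕-cong (∘ₚ-const a h)
          (≈-trans (∘ₚ-⊗ g (f ∘ₚ g) h) (⊗-congʳ (g ∘ₚ h) (∘ₚ-assoc f g h))))

X⊗ : ∀ f → X^ 1 ⊗ f ≈ 0ℤ ∷ f
X⊗ f = ≈-trans (shift-⊗ one f) (∷-cong refl (⊗-identityˡ f))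

∘ₚ-identityʳ : ∀ f → f ∘ₚ X^ 1 ≈ f
∘ₚ-identityʳ []      = ≈-refl
∘ₚ-identityʳ (a ∷ f) = ≈-trans (⊕-cong (≈-refl {const a}) (X⊗ (f ∘ₚ X^ 1)))
  (∷-cong (ℤₚ.+-identityʳ a) (∘ₚ-identityʳ f))

X^-∘ₚ : ∀ n p → X^ n ∘ₚ X^ p ≈ X^ (n * p)
X^-∘ₚ zero    p = ∘ₚ-const 1ℤ (X^ p)
X^-∘ₚ (suc n) p = ≈-trans (∘ₚ-shift (X^ n) (X^ p))
  (≈-trans (⊗-congʳ (X^ p) (X^-∘ₚ n p)) (≈-sym (X^-+ p (n * p))))

xⁿ-1-∘ₚ : ∀ n p → xⁿ-1 n ∘ₚ X^ p ≈ xⁿ-1 (n * p)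
xⁿ-1-∘ₚ n p = begin
  xⁿ-1 n ∘ₚ X^ p                       ≈⟨ ∘ₚ-congˡ (X^ p) (xⁿ-1≈ n) ⟩
  (X^ n ⊕ const ℤ.-1ℤ) ∘ₚ X^ p         ≈⟨ ∘ₚ-⊕ (X^ n) (const ℤ.-1ℤ) (X^ p) ⟩
  X^ n ∘ₚ X^ p ⊕ const ℤ.-1ℤ ∘ₚ X^ p   ≈⟨ ⊕-cong (X^-∘ₚ n p) (∘ₚ-const ℤ.-1ℤ (X^ p)) ⟩
  X^ (n * p) ⊕ const ℤ.-1ℤ             ≈⟨ xⁿ-1≈ (n * p) ⟨
  xⁿ-1 (n * p)                         ∎
  where open ≈-Reasoning

prod₁-∘ₚ : ∀ F n g N → prod₁ (λ k → F Πₚ.when k ∣ n) N ∘ₚ g ≈ prod₁ (λ k → (λ j → F j ∘ₚ g) Πₚ.when k ∣ n) N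
prod₁-∘ₚ F n g zero    = ∘ₚ-const 1ℤ g
prod₁-∘ₚ F n g (suc N) = ≈-trans
  (∘ₚ-⊗ (F Πₚ.when (suc N) ∣ n) (prod₁ (λ k → F Πₚ.when k ∣ n) N) g)
  (⊗-cong (distribute (does (suc N ∣? n))) (prod₁-∘ₚ F n g N))
  where
  distribute : ∀ b → (if b then F (suc N) else one) ∘ₚ g ≈ (if b then F (suc N) ∘ₚ g else one)
  distribute true  = ≈-refl
  distribute false = ∘ₚ-const 1ℤ g

-- Applied to x^(1+sm) and x, it shows that modulo F the two substitutions have the same effect.
∘ₚ-difference : ∀ f g h → g ⊕ ⊝ h ∣ₚ f ∘ₚ g ⊕ ⊝ (f ∘ₚ h)
∘ₚ-difference []      g h = dividesₚ [] (≈-sym (⊗-zeroʳ (g ⊕ ⊝ h)))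
∘ₚ-difference (a ∷ f) g h with ∘ₚ-difference f g h
... | dividesₚ k eq = dividesₚ (f ∘ₚ g ⊕ h ⊗ k) (begin
  (const a ⊕ g ⊗ (f ∘ₚ g)) ⊕ ⊝ (const a ⊕ h ⊗ (f ∘ₚ h))
    ≈⟨ split (const a) g h (f ∘ₚ g) (f ∘ₚ h) ⟩
  (g ⊕ ⊝ h) ⊗ (f ∘ₚ g) ⊕ h ⊗ (f ∘ₚ g ⊕ ⊝ (f ∘ₚ h))
    ≈⟨ ⊕-cong (≈-refl {(g ⊕ ⊝ h) ⊗ (f ∘ₚ g)}) (⊗-congʳ h eq) ⟩
  (g ⊕ ⊝ h) ⊗ (f ∘ₚ g) ⊕ h ⊗ ((g ⊕ ⊝ h) ⊗ k)
    ≈⟨ factor (g ⊕ ⊝ h) (f ∘ₚ g) h k ⟩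
  (g ⊕ ⊝ h) ⊗ (f ∘ₚ g ⊕ h ⊗ k) ∎)
  where
  open ≈-Reasoning
  split : ∀ a g h s t → (a ⊕ g ⊗ s) ⊕ ⊝ (a ⊕ h ⊗ t) ≈ (g ⊕ ⊝ h) ⊗ s ⊕ h ⊗ (s ⊕ ⊝ t)
  split = Ring.solve-∀ solverRing
  factor : ∀ d s h k → d ⊗ s ⊕ h ⊗ (d ⊗ k) ≈ d ⊗ (s ⊕ h ⊗ k)
  factor = Ring.solve-∀ solverRing

∘ₚ-∣ₚ : ∀ {f h} g → f ∣ₚ h → f ∘ₚ g ∣ₚ h ∘ₚ g
∘ₚ-∣ₚ {f} g (dividesₚ k eq) = dividesₚ (k ∘ₚ g) (≈-trans (∘ₚ-congˡ g eq) (∘ₚ-⊗ f k g))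

-- Low coefficients, and degrees after x ↦ x^p

coef-X^⊗ : ∀ k f {n} → n < k → coef (X^ k ⊗ f) n ≡ 0ℤ
coef-X^⊗ (suc k) f {zero}  _         = shift-⊗ (X^ k) f .at 0
coef-X^⊗ (suc k) f {suc n} (s≤s n<k) = trans (shift-⊗ (X^ k) f .at (suc n)) (coef-X^⊗ k f n<k)

coef-X^⊗-+ : ∀ k f n → coef (X^ k ⊗ f) (k + n) ≡ coef f n
coef-X^⊗-+ zero    f n = ⊗-identityˡ f .at n
coef-X^⊗-+ (suc k) f n = trans (shift-⊗ (X^ k) f .at (suc (k + n))) (coef-X^⊗-+ k f n)

coef-low : ∀ {f} g k h {n} → f ≈ g ⊕ X^ k ⊗ h → n < k → coef f n ≡ coef g n
coef-low {f} g k h {n} f≈ n<k = begin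
  coef f n                          ≡⟨ f≈ .at n ⟩
  coef (g ⊕ X^ k ⊗ h) n             ≡⟨ coef-⊕ g (X^ k ⊗ h) n ⟩
  coef g n ℤ.+ coef (X^ k ⊗ h) n    ≡⟨ cong (λ z → coef g n ℤ.+ z) (coef-X^⊗ k h n<k) ⟩
  coef g n ℤ.+ 0ℤ                   ≡⟨ ℤₚ.+-identityʳ _ ⟩
  coef g n                          ∎
  where open ≡-Reasoning

Deg<-const : ∀ a d → Deg< (suc d) (const a)
Deg<-const a d = Deg<-mono (s≤s z≤n) (Deg<-length (const a))

Deg<-∘ₚX^ : ∀ p {d} f → Deg< (suc d) f → Deg< (suc (d * p)) (f ∘ₚ X^ p)
Deg<-∘ₚX^ p []      df = vanishing λ _ _ → refl
Deg<-∘ₚX^ p {zero}  (a ∷ f) df = Deg<-≈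
  (≈-sym (≈-trans (∘ₚ-congˡ (X^ p) (∷-cong refl (Deg<0⇒≈0 (Deg<-tail df)))) (∘ₚ-const a (X^ p))))
  (Deg<-const a 0)
Deg<-∘ₚX^ p {suc d} (a ∷ f) df = Deg<-⊕ (Deg<-const a _)
  (Deg<-⊗ (Monic-X^ p .deg) (Deg<-∘ₚX^ p f (Deg<-tail df)))

coef-∘ₚX^-top : ∀ p .{{_ : ℕ.NonZero p}} {d} f → Deg< (suc d) f → coef (f ∘ₚ X^ p) (d * p) ≡ coef f d
coef-∘ₚX^-top p []      df = refl
coef-∘ₚX^-top p {zero}  (a ∷ f) df =
  ≈-trans (∘ₚ-congˡ (X^ p) (∷-cong refl (Deg<0⇒≈0 (Deg<-tail df)))) (∘ₚ-const a (X^ p)) .at 0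
coef-∘ₚX^-top p@(suc p′) {suc d} (a ∷ f) df = begin
  coef (const a ⊕ X^ p ⊗ (f ∘ₚ X^ p)) (p + d * p)
    ≡⟨ coef-⊕ (const a) (X^ p ⊗ (f ∘ₚ X^ p)) (p + d * p) ⟩
  0ℤ ℤ.+ coef (X^ p ⊗ (f ∘ₚ X^ p)) (p + d * p)
    ≡⟨ ℤₚ.+-identityˡ _ ⟩
  coef (X^ p ⊗ (f ∘ₚ X^ p)) (p + d * p)
    ≡⟨ coef-X^⊗-+ p (f ∘ₚ X^ p) (d * p) ⟩
  coef (f ∘ₚ X^ p) (d * p)
    ≡⟨ coef-∘ₚX^-top p f (Deg<-tail df) ⟩
  coef f d ∎
  where open ≡-Reasoning

Monic-∘ₚX^ : ∀ {d f} p .{{_ : ℕ.NonZero p}} → Monic d f → Monic (d * p) (f ∘ₚ X^ p)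
Monic-∘ₚX^ {f = f} p (monic l df) = monic (trans (coef-∘ₚX^-top p f df) l) (Deg<-∘ₚX^ p f df)

∘ₚ-head : ∀ f p → ∃ λ g → f ∘ₚ X^ p ≈ const (coef f 0) ⊕ X^ p ⊗ g
∘ₚ-head []      p = [] , ≈-sym (⊕-cong shift-zero (⊗-zeroʳ (X^ p)))
∘ₚ-head (a ∷ f) p = f ∘ₚ X^ p , ≈-refl

-- The identity F(x^p) = F C

-- Over all k | m, the products of Φ_k(x^p) and of Φ_k Φ_(kp) both equal x^(mp) - 1, because the
-- divisors of m p are the k and the k p. By induction the factors for proper divisors agree; they
-- are monic and cancel.
Φ-∘ₚ-X^ : ∀ {p} → Prime p → ∀ m → 0 < m → p ∤ m → Φ m ∘ₚ X^ p ≈ Φ m ⊗ Φ (m * p)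
Φ-∘ₚ-X^ {p} pr = <-rec (λ m → 0 < m → p ∤ m → Φ m ∘ₚ X^ p ≈ Φ m ⊗ Φ (m * p)) step
  where
  open ≈-Reasoning
  instance
    p≢0 : ℕ.NonZero p
    p≢0 = prime⇒nonZero pr
  G H : ℕ → Poly
  G k = Φ k ∘ₚ X^ p
  H k = Φ k ⊗ Φ (k * p)
  ΠG≈ΠH : ∀ m .{{_ : ℕ.NonZero m}} → p ∤ m → Π∣ G m ≈ Π∣ H m
  ΠG≈ΠH m p∤m = begin
    Π∣ G m                             ≈⟨ prod₁-∘ₚ Φ m (X^ p) m ⟨
    Π∣ Φ m ∘ₚ X^ p                     ≈⟨ ∘ₚ-congˡ (X^ p) (cyclotomic m (ℕ.>-nonZero⁻¹ m) .product) ⟩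
    xⁿ-1 m ∘ₚ X^ p                     ≈⟨ xⁿ-1-∘ₚ m p ⟩
    xⁿ-1 (m * p)                       ≈⟨ cyclotomic (m * p) (ℕ.>-nonZero⁻¹ (m * p) {{ℕₚ.m*n≢0 m p}}) .product ⟨
    Π∣ Φ (m * p)                       ≈⟨ Πₚ.overDivisors-*-prime Φ m p pr p∤m ⟩
    Π∣ Φ m ⊗ Π∣ (λ j → Φ (j * p)) m    ≈⟨ Πₚ.overDivisors-∙ Φ (λ j → Φ (j * p)) m ⟨
    Π∣ H m                             ∎
  step : ∀ m → (∀ {k} → k < m → 0 < k → p ∤ k → G k ≈ H k) → 0 < m → p ∤ m → G m ≈ H m
  step (suc m) rec _ p∤m = ⊗-cancelˡ mQ (begin
    Q ⊗ G (suc m)                ≈⟨ ⊗-comm Q (G (suc m)) ⟩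
    G (suc m) ⊗ Q                ≈⟨ Πₚ.overDivisors-suc G m ⟨
    Π∣ G (suc m)                 ≈⟨ ΠG≈ΠH (suc m) p∤m ⟩
    Π∣ H (suc m)                 ≈⟨ Πₚ.overDivisors-suc H m ⟩
    H (suc m) ⊗ prod₁ (λ k → H Πₚ.when k ∣ suc m) m
                                 ≈⟨ ⊗-congʳ (H (suc m)) (Πₚ.big-cong m λ k 0<k k≤m → proper k 0<k k≤m (k ∣? suc m)) ⟨
    H (suc m) ⊗ Q                ≈⟨ ⊗-comm (H (suc m)) Q ⟩
    Q ⊗ H (suc m)                ∎)
    where
    Q = prod₁ (λ k → G Πₚ.when k ∣ suc m) m
    mQ = prod₁-monic (suc m) m λ k 0<k _ → Monic-∘ₚX^ p (cyclotomic k 0<k .degree)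
    proper : ∀ k → 0 < k → k ≤ m → (k∣? : Dec (k ∣ suc m)) →
             (if does k∣? then G k else one) ≈ (if does k∣? then H k else one)
    proper k 0<k k≤m (yes k∣m) = rec (s≤s k≤m) 0<k λ p∣k → p∤m (∣-trans p∣k k∣m)
    proper k 0<k k≤m (no  _)   = ≈-refl

-- A power of p congruent to 1 modulo m

coprime-cancel-^ : ∀ {m p} → Coprime m p → ∀ i {k} → m ∣ p ^ i * k → m ∣ k
coprime-cancel-^ c zero    {k} m∣ = subst (_ ∣_) (ℕₚ.*-identityˡ k) m∣
coprime-cancel-^ {m} {p} c (suc i) {k} m∣ =
  coprime-cancel-^ c i (coprime-divisor c (subst (m ∣_) (ℕₚ.*-assoc p (p ^ i) k) m∣))

%-≡⇒∣∸ : ∀ a b m .{{_ : ℕ.NonZero m}} → a % m ≡ b % m → m ∣ a ∸ b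
%-≡⇒∣∸ a b m eq = divides (a / m ∸ b / m) (begin
  a ∸ b                                          ≡⟨ cong₂ _∸_ (m≡m%n+[m/n]*n a m) (m≡m%n+[m/n]*n b m) ⟩
  (a % m + a / m * m) ∸ (b % m + b / m * m)      ≡⟨ cong (λ r → (a % m + a / m * m) ∸ (r + b / m * m)) eq ⟨
  (a % m + a / m * m) ∸ (a % m + b / m * m)      ≡⟨ ℕₚ.[m+n]∸[m+o]≡n∸o (a % m) _ _ ⟩
  a / m * m ∸ b / m * m                          ≡⟨ ℕₚ.*-distribʳ-∸ m (a / m) (b / m) ⟨
  (a / m ∸ b / m) * m                            ∎)
  where open ≡-Reasoning

-- Two of the m + 1 powers p^0, ..., p^m share a residue, and the smaller can be cancelled. The
-- exponent has the form `suc t` because one factor `p` is the substitution to be undone and the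
-- other `t` undo it.
power≡1 : ∀ m p .{{_ : ℕ.NonZero m}} .{{_ : ℕ.NonZero p}} → Coprime m p →
          ∃₂ λ t s → p ^ suc t ≡ 1 + s * m
power≡1 m p c with pigeonhole (ℕₚ.n<1+n m) (λ i → (p ^ toℕ i) mod m)
... | i , j , i<j , eq with ℕₚ.m≤n⇒∃[o]m+o≡n i<j
...   | t , i+1+t≡j with coprime-cancel-^ c (toℕ i) (subst (m ∣_) difference
                           (%-≡⇒∣∸ (p ^ toℕ j) (p ^ toℕ i) m (sym residues)))
  where
  open ≡-Reasoning
  residues : p ^ toℕ i % m ≡ p ^ toℕ j % m
  residues = begin
    p ^ toℕ i % m              ≡⟨ toℕ-fromℕ< (m%n<n (p ^ toℕ i) m) ⟨
    toℕ ((p ^ toℕ i) mod m)    ≡⟨ cong toℕ eq ⟩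
    toℕ ((p ^ toℕ j) mod m)    ≡⟨ toℕ-fromℕ< (m%n<n (p ^ toℕ j) m) ⟩
    p ^ toℕ j % m              ∎
  difference : p ^ toℕ j ∸ p ^ toℕ i ≡ p ^ toℕ i * (p ^ suc t ∸ 1)
  difference = begin
    p ^ toℕ j ∸ p ^ toℕ i                  ≡⟨ cong (λ k → p ^ k ∸ p ^ toℕ i) (trans (ℕₚ.+-suc (toℕ i) t) i+1+t≡j) ⟨
    p ^ (toℕ i + suc t) ∸ p ^ toℕ i        ≡⟨ cong₂ _∸_ (ℕₚ.^-distribˡ-+-* p (toℕ i) (suc t)) (sym (ℕₚ.*-identityʳ (p ^ toℕ i))) ⟩
    p ^ toℕ i * p ^ suc t ∸ p ^ toℕ i * 1  ≡⟨ ℕₚ.*-distribˡ-∸ (p ^ toℕ i) (p ^ suc t) 1 ⟨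
    p ^ toℕ i * (p ^ suc t ∸ 1)            ∎
...     | divides s eq′ = t , s , trans (sym (ℕₚ.m+[n∸m]≡n (ℕₚ.m^n>0 p (suc t)))) (cong suc eq′)

-- Maximum gap

record Consecutive (c : ℕ → ℤ) (i j : ℕ) : Set where
  constructor consecutive
  field
    i<j     : i < j
    ci≢0    : c i ≢ 0ℤ
    cj≢0    : c j ≢ 0ℤ
    between : ∀ n → i < n → n < j → c n ≡ 0ℤ

exponentsFrom-≢0 : ∀ k {a} f → a ≢ 0ℤ → exponentsFrom k (a ∷ f) ≡ k ∷ exponentsFrom (suc k) f
exponentsFrom-≢0 k {+ 0}         f a≢0 = contradiction refl a≢0
exponentsFrom-≢0 k {ℤ.+[1+ _ ]}  f a≢0 = refl
exponentsFrom-≢0 k {ℤ.-[1+ _ ]}  f a≢0 = refl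

largest : List ℕ → ℕ
largest = foldr _⊔_ 0

module _ (c : ℕ → ℤ) where

  -- The scan for exponents sees only the part of the list that is left after `k` entries. This ties
  -- it to the full sequence `c`, in which gaps are measured.
  Tail : ℕ → Poly → Set
  Tail k f = ∀ t → coef f t ≡ c (k + t)

  Tail-head : ∀ {k a f} → Tail k (a ∷ f) → c k ≡ a
  Tail-head {k} tl = trans (cong c (sym (ℕₚ.+-identityʳ k))) (sym (tl 0))

  Tail-tail : ∀ {k a f} → Tail k (a ∷ f) → Tail (suc k) f
  Tail-tail {k} tl t = trans (tl (suc t)) (cong c (ℕₚ.+-suc k t))

  module _ (δ : ℕ) (bound : ∀ i j → Consecutive c i j → j ∸ i ≤ δ) where

    -- The loop invariant: `x` is the last exponent met, and the scan has found only zeros from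
    -- there up to `k`.
    gapsAfter-≤ : ∀ f k x → Tail k f → x < k → c x ≢ 0ℤ → (∀ n → x < n → n < k → c n ≡ 0ℤ) →
                  largest (diffs (x ∷ exponentsFrom k f)) ≤ δ
    gapsAfter-≤ []      k x tl x<k cx≢0 zeros = z≤n
    gapsAfter-≤ (a ∷ f) k x tl x<k cx≢0 zeros with a ℤ.≟ 0ℤ
    ... | yes refl = gapsAfter-≤ f (suc k) x (Tail-tail {f = f} tl) (ℕₚ.m<n⇒m<1+n x<k) cx≢0 zeros′
      where
      zeros′ : ∀ n → x < n → n < suc k → c n ≡ 0ℤ
      zeros′ n x<n (s≤s n≤k) with ℕₚ.m≤n⇒m<n∨m≡n n≤k
      ... | inj₁ n<k  = zeros n x<n n<k
      ... | inj₂ refl = Tail-head {f = f} tl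
    ... | no a≢0 rewrite exponentsFrom-≢0 k f a≢0 = ℕₚ.⊔-lub
      (bound x k (consecutive x<k cx≢0 ck≢0 zeros))
      (gapsAfter-≤ f (suc k) k (Tail-tail {f = f} tl) ℕₚ.≤-refl ck≢0
        λ n k<n n<1+k → contradiction n<1+k (ℕₚ.≤⇒≯ k<n))
      where
      ck≢0 : c k ≢ 0ℤ
      ck≢0 = a≢0 ∘ trans (sym (Tail-head {f = f} tl))

    gapsFrom-≤ : ∀ f k → Tail k f → largest (diffs (exponentsFrom k f)) ≤ δ
    gapsFrom-≤ []      k tl = z≤n
    gapsFrom-≤ (a ∷ f) k tl with a ℤ.≟ 0ℤ
    ... | yes refl = gapsFrom-≤ f (suc k) (Tail-tail {f = f} tl)
    ... | no a≢0 rewrite exponentsFrom-≢0 k f a≢0 =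
      gapsAfter-≤ f (suc k) k (Tail-tail {f = f} tl) ℕₚ.≤-refl (a≢0 ∘ trans (sym (Tail-head {f = f} tl)))
        λ n k<n n<1+k → contradiction n<1+k (ℕₚ.≤⇒≯ k<n)

  module _ {i j : ℕ} (con : Consecutive c i j) where
    open Consecutive con

    Tail-[] : ∀ {k} → k ≤ j → ¬ Tail k []
    Tail-[] {k} k≤j tl = cj≢0 (trans (cong c (sym (ℕₚ.m+[n∸m]≡n k≤j))) (sym (tl (j ∸ k))))

    skip : ∀ {k l} → k ≤ l → c k ≡ 0ℤ → c l ≢ 0ℤ → k < l
    skip k≤l ck≡0 cl≢0 = ℕₚ.≤∧≢⇒< k≤l λ { refl → cl≢0 ck≡0 }

    -- The disjunction records the position of the scan: inside the gap, with `i` as the last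
    -- exponent met, or not yet past `i`.
    gapsAfter-≥ : ∀ f k x → Tail k f → (x ≡ i × i < k × k ≤ j) ⊎ k ≤ i →
                  j ∸ i ≤ largest (diffs (x ∷ exponentsFrom k f))
    gapsAfter-≥ [] k x tl (inj₁ (_ , _ , k≤j)) = contradiction tl (Tail-[] k≤j)
    gapsAfter-≥ [] k x tl (inj₂ k≤i)           = contradiction tl (Tail-[] (ℕₚ.≤-trans k≤i (ℕₚ.<⇒≤ i<j)))
    gapsAfter-≥ (a ∷ f) k x tl pos with a ℤ.≟ 0ℤ
    ... | yes refl = gapsAfter-≥ f (suc k) x (Tail-tail {f = f} tl) (advance pos)
      where
      ck≡0 : c k ≡ 0ℤ
      ck≡0 = Tail-head {f = f} tl
      advance : (x ≡ i × i < k × k ≤ j) ⊎ k ≤ i → (x ≡ i × i < suc k × suc k ≤ j) ⊎ suc k ≤ i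
      advance (inj₁ (x≡i , i<k , k≤j)) = inj₁ (x≡i , ℕₚ.m<n⇒m<1+n i<k , skip k≤j ck≡0 cj≢0)
      advance (inj₂ k≤i)               = inj₂ (skip k≤i ck≡0 ci≢0)
    ... | no a≢0 rewrite exponentsFrom-≢0 k f a≢0 = visit pos
      where
      rest = largest (diffs (k ∷ exponentsFrom (suc k) f))
      visit : (x ≡ i × i < k × k ≤ j) ⊎ k ≤ i → j ∸ i ≤ (k ∸ x) ⊔ rest
      visit (inj₁ (refl , i<k , k≤j)) with ℕₚ.m≤n⇒m<n∨m≡n k≤j
      ... | inj₁ k<j  = contradiction (trans (sym (Tail-head {f = f} tl)) (between k i<k k<j)) a≢0
      ... | inj₂ refl = ℕₚ.m≤m⊔n (k ∸ x) rest
      visit (inj₂ k≤i) = ℕₚ.≤-trans (gapsAfter-≥ f (suc k) k (Tail-tail {f = f} tl) next) (ℕₚ.m≤n⊔m (k ∸ x) rest)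
        where
        next : (k ≡ i × i < suc k × suc k ≤ j) ⊎ suc k ≤ i
        next with ℕₚ.m≤n⇒m<n∨m≡n k≤i
        ... | inj₁ k<i  = inj₂ k<i
        ... | inj₂ refl = inj₁ (refl , ℕₚ.≤-refl , i<j)

    gapsFrom-≥ : ∀ f k → Tail k f → k ≤ i → j ∸ i ≤ largest (diffs (exponentsFrom k f))
    gapsFrom-≥ [] k tl k≤i = contradiction tl (Tail-[] (ℕₚ.≤-trans k≤i (ℕₚ.<⇒≤ i<j)))
    gapsFrom-≥ (a ∷ f) k tl k≤i with a ℤ.≟ 0ℤ
    ... | yes refl = gapsFrom-≥ f (suc k) (Tail-tail {f = f} tl) (skip k≤i (Tail-head {f = f} tl) ci≢0)
    ... | no a≢0 rewrite exponentsFrom-≢0 k f a≢0 =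
      gapsAfter-≥ f (suc k) k (Tail-tail {f = f} tl) next
      where
      next : (k ≡ i × i < suc k × suc k ≤ j) ⊎ suc k ≤ i
      next with ℕₚ.m≤n⇒m<n∨m≡n k≤i
      ... | inj₁ k<i  = inj₂ k<i
      ... | inj₂ refl = inj₁ (refl , ℕₚ.≤-refl , i<j)

maxGap-≤ : ∀ f {δ} → (∀ i j → Consecutive (coef f) i j → j ∸ i ≤ δ) → maxGap f ≤ δ
maxGap-≤ f {δ} bound = subst (λ es → largest (diffs es) ≤ δ) (sym (exponents-exponentsFrom f))
  (gapsFrom-≤ (coef f) δ bound f 0 λ _ → refl)

maxGap-≥ : ∀ f {i j} → Consecutive (coef f) i j → j ∸ i ≤ maxGap f
maxGap-≥ f {i} {j} con = subst (λ es → j ∸ i ≤ largest (diffs es)) (sym (exponents-exponentsFrom f))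
  (gapsFrom-≥ (coef f) con f 0 (λ _ → refl) z≤n)

take-drop : ∀ k f → f ≈ take k f ⊕ X^ k ⊗ drop k f
take-drop zero    f       = ≈-sym (⊗-identityˡ f)
take-drop (suc k) []      = ≈-sym (⊗-zeroʳ (X^ suc k))
take-drop (suc k) (a ∷ f) = ≈-trans (∷-cong (sym (ℤₚ.+-identityʳ a)) (take-drop k f))
  (⊕-cong (≈-refl {a ∷ take k f}) (≈-sym (shift-⊗ (X^ k) (drop k f))))

Deg<-take : ∀ k f → Deg< k (take k f)
Deg<-take k f = Deg<-mono (ℕₚ.≤-trans (ℕₚ.≤-reflexive (Listₚ.length-take k f)) (ℕₚ.m⊓n≤m k (length f))) (Deg<-length (take k f))

-- The two bounds for the maximum gap

module _ {m p : ℕ} (0<m : 0 < m) (pr : Prime p) (m<p : m < p) where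

  private
    instance
      m≢0 : ℕ.NonZero m
      m≢0 = ℕ.>-nonZero 0<m
      p≢0 : ℕ.NonZero p
      p≢0 = prime⇒nonZero pr
      mp≢0 : ℕ.NonZero (m * p)
      mp≢0 = ℕₚ.m*n≢0 m p

    F = Φ m
    C = Φ (m * p)
    δ = φ m
    a₀ = coef F 0

    mF : Monic δ F
    mF = cyclotomic m 0<m .degree

    0<δ : 0 < δ
    0<δ = 0<φ m 0<m

    δ≤m : δ ≤ m
    δ≤m = φ≤ m

    FXᵖ≈FC : F ∘ₚ X^ p ≈ F ⊗ C
    FXᵖ≈FC = Φ-∘ₚ-X^ pr m 0<m (>⇒∤ m<p)

    F∣xᵐ-1 : F ∣ₚ xⁿ-1 m
    F∣xᵐ-1 = Φ-∣-xⁿ-1 0<m (cyclotomic m 0<m)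

    Ψ = F∣xᵐ-1 .quotient

    xᵐ-1≈FΨ : xⁿ-1 m ≈ F ⊗ Ψ
    xᵐ-1≈FΨ = F∣xᵐ-1 .equality

    a₀ψ₀≡-1 : a₀ ℤ.* coef Ψ 0 ≡ ℤ.-1ℤ
    a₀ψ₀≡-1 = trans (sym (coef-⊗-zero F Ψ)) (trans (sym (xᵐ-1≈FΨ .at 0)) (constant m 0<m))
      where
      constant : ∀ m → 0 < m → coef (xⁿ-1 m) 0 ≡ ℤ.-1ℤ
      constant (suc m) _ = refl

    a₀≢0 : a₀ ≢ 0ℤ
    a₀≢0 a₀≡0 with () ← trans (sym a₀ψ₀≡-1) (cong (ℤ._* coef Ψ 0) a₀≡0)

  Φ-∣-∘ₚ-X^ : ∀ t → F ∣ₚ F ∘ₚ X^ (p ^ t)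
  Φ-∣-∘ₚ-X^ zero    = dividesₚ one (≈-trans (∘ₚ-identityʳ F) (≈-sym (CommutativeRing.*-identityʳ ℤ[x] F)))
  Φ-∣-∘ₚ-X^ (suc t) = ∣ₚ-trans (Φ-∣-∘ₚ-X^ t)
    (∣ₚ-≈ʳ (≈-trans (∘ₚ-assoc F (X^ p) (X^ (p ^ t))) (∘ₚ-congʳ F (X^-∘ₚ p (p ^ t))))
      (∘ₚ-∣ₚ {F} (X^ (p ^ t)) (dividesₚ C FXᵖ≈FC)))

  -- Substituting x ↦ x^p permutes the primitive m-th roots of unity:
  -- undo it with x ↦ x^(p^t), where p^(1+t) ≡ 1 (mod m).
  Φ-∣-∘ₚ⁻¹ : ∀ h → F ∣ₚ h ∘ₚ X^ p → F ∣ₚ h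
  Φ-∣-∘ₚ⁻¹ h F∣hXᵖ with power≡1 m p (∤⇒coprime pr (>⇒∤ m<p))
  ... | t , s , p^1+t≡1+sm = ∣ₚ-≈ʳ (≈-trans (cancel (h ∘ₚ X^ (1 + s * m)) (h ∘ₚ X^ 1)) (∘ₚ-identityʳ h))
    (∣ₚ-⊕ F∣hX^1+sm (∣ₚ-⊝ F∣difference))
    where
    cancel : ∀ a b → a ⊕ ⊝ (a ⊕ ⊝ b) ≈ b
    cancel = Ring.solve-∀ solverRing
    -- F divides F(x^(p^t)), and the substitution x^(p^t) in F | h(x^p) shows that this divides
    -- h(x^(p^(1+t))).
    F∣hX^1+sm : F ∣ₚ h ∘ₚ X^ (1 + s * m)
    F∣hX^1+sm = ∣ₚ-trans (Φ-∣-∘ₚ-X^ t) (∣ₚ-≈ʳ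
      (≈-trans (∘ₚ-assoc h (X^ p) (X^ (p ^ t))) (∘ₚ-congʳ h
        (subst (λ n → X^ p ∘ₚ X^ (p ^ t) ≈ X^ n) p^1+t≡1+sm (X^-∘ₚ p (p ^ t)))))
      (∘ₚ-∣ₚ (X^ (p ^ t)) F∣hXᵖ))
    factor : ∀ x y → (y ⊕ ⊝ one) ⊗ x ≈ x ⊗ y ⊕ ⊝ x
    factor = Ring.solve-∀ solverRing
    exponent-difference : xⁿ-1 (s * m) ⊗ X^ 1 ≈ X^ (1 + s * m) ⊕ ⊝ X^ 1
    exponent-difference = ≈-trans (⊗-cong (xⁿ-1≈ (s * m)) (≈-refl {X^ 1}))
      (≈-trans (factor (X^ 1) (X^ (s * m))) (⊕-cong (≈-sym (X^-+ 1 (s * m))) ≈-refl))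
    -- The inner polynomials differ by x (x^(sm) - 1), which is a multiple of x^m - 1.
    F∣difference : F ∣ₚ h ∘ₚ X^ (1 + s * m) ⊕ ⊝ (h ∘ₚ X^ 1)
    F∣difference = ∣ₚ-trans
      (∣ₚ-≈ʳ exponent-difference (∣ₚ-⊗ʳ (X^ 1) (∣ₚ-trans F∣xᵐ-1 (∣⇒xⁿ-1∣ (n∣m*n s)))))
      (∘ₚ-difference h (X^ (1 + s * m)) (X^ 1))

  -- Comparing degrees in F(x^p) = F C gives the value of φ(m p) without the multiplicativity of φ.
  degree-Φ[mp] : δ * p ≡ δ + φ (m * p)
  degree-Φ[mp] = Monic-degree-unique (Monic-∘ₚX^ p mF)
    (Monic-≈ (≈-sym FXᵖ≈FC) (Monic-⊗ mF (cyclotomic (m * p) (ℕ.>-nonZero⁻¹ (m * p)) .degree)))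

  -- If C = A + x^(e+1) B with deg A + δ ≤ e, then F A is the part of F(x^p) of degree ≤ e.
  truncation : ∀ {i j} → Consecutive (coef C) i j → i + δ < j →
               F ∣ₚ take (suc ((i + δ) / p)) F ∘ₚ X^ p
  truncation {i} {j} (consecutive i<j _ _ between) e<j = dividesₚ A (coeffwise agree)
    where
    e = i + δ
    b = e / p
    A = take (suc e) C
    h = take (suc b) F
    C≈ : C ≈ A ⊕ X^ suc e ⊗ drop (suc e) C
    C≈ = take-drop (suc e) C
    -- The cut keeps exponents up to `e`, but those beyond `i` lie inside the gap.
    dA : Deg< (suc i) A
    dA .above n i<n with suc e ℕ.≤? n
    ... | yes e<n = Deg<-take (suc e) C .above n e<n
    ... | no  e≮n = trans (sym (coef-low A (suc e) (drop (suc e) C) C≈ (ℕₚ.≰⇒> e≮n)))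
                          (between n i<n (ℕₚ.≤-<-trans (ℕₚ.≤-pred (ℕₚ.≰⇒> e≮n)) e<j))
    expand : ∀ f a x b → f ⊗ (a ⊕ x ⊗ b) ≈ f ⊗ a ⊕ x ⊗ (f ⊗ b)
    expand = Ring.solve-∀ solverRing
    FC≈ : F ⊗ C ≈ F ⊗ A ⊕ X^ suc e ⊗ (F ⊗ drop (suc e) C)
    FC≈ = ≈-trans (⊗-congʳ F C≈) (expand F A (X^ suc e) (drop (suc e) C))
    FXᵖ≈ : F ∘ₚ X^ p ≈ h ∘ₚ X^ p ⊕ X^ (suc b * p) ⊗ (drop (suc b) F ∘ₚ X^ p)
    FXᵖ≈ = ≈-trans (∘ₚ-congˡ (X^ p) (take-drop (suc b) F))
      (≈-trans (∘ₚ-⊕ h (X^ suc b ⊗ drop (suc b) F) (X^ p))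
        (⊕-cong (≈-refl {h ∘ₚ X^ p}) (≈-trans (∘ₚ-⊗ (X^ suc b) (drop (suc b) F) (X^ p))
          (⊗-cong (X^-∘ₚ (suc b) p) ≈-refl))))
    -- The first exponent of F(x^p) that `h` may miss is (b + 1) p, and it is already past the cut.
    e<[1+b]p : e < suc b * p
    e<[1+b]p = subst (_< suc b * p) (sym (m≡m%n+[m/n]*n e p)) (ℕₚ.+-monoˡ-< (b * p) (m%n<n e p))
    -- Past `e` both sides vanish for reasons of degree; up to `e` each is the low part of one side
    -- of F(x^p) = F C.
    agree : ∀ n → coef (h ∘ₚ X^ p) n ≡ coef (F ⊗ A) n
    agree n with suc e ℕ.≤? n
    ... | yes e<n = trans
      (Deg<-∘ₚX^ p h (Deg<-take (suc b) F) .above n (ℕₚ.≤-trans (s≤s (m/n*n≤m e p)) e<n))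
      (sym (Deg<-⊗ (mF .deg) dA .above n (subst (λ d → suc d ≤ n) (ℕₚ.+-comm i δ) e<n)))
    ... | no  e≮n = trans
      (sym (coef-low (h ∘ₚ X^ p) (suc b * p) (drop (suc b) F ∘ₚ X^ p) FXᵖ≈ (ℕₚ.≤-<-trans (ℕₚ.≤-pred (ℕₚ.≰⇒> e≮n)) e<[1+b]p)))
      (trans (FXᵖ≈FC .at n) (coef-low (F ⊗ A) (suc e) (F ⊗ drop (suc e) C) FC≈ (ℕₚ.≰⇒> e≮n)))

  gap-≤ : ∀ i j → Consecutive (coef C) i j → j ∸ i ≤ δ
  gap-≤ i j con@(consecutive i<j _ cj≢0 _) with j ∸ i ℕ.≤? δ
  ... | yes small = small
  ... | no  large = contradiction (trans a₀≡h₀ (h≈0 .at 0)) a₀≢0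
    where
    i+δ<j : i + δ < j
    i+δ<j = subst (i + δ <_) (ℕₚ.m+[n∸m]≡n (ℕₚ.<⇒≤ i<j)) (ℕₚ.+-monoʳ-< i (ℕₚ.≰⇒> large))
    b = (i + δ) / p
    h = take (suc b) F
    a₀≡h₀ : a₀ ≡ coef h 0
    a₀≡h₀ = coef-low h (suc b) (drop (suc b) F) (take-drop (suc b) F) (s≤s z≤n)
    j≤deg : j ≤ φ (m * p)
    j≤deg = ℕₚ.≮⇒≥ λ deg<j → cj≢0 (cyclotomic (m * p) (ℕ.>-nonZero⁻¹ (m * p)) .degree .deg .above j deg<j)
    -- From i + δ < j ≤ deg C and deg C ≤ δ p.
    b<δ : b < δ
    b<δ = m<n*o⇒m/o<n (ℕₚ.<-≤-trans i+δ<j (ℕₚ.≤-trans j≤deg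
      (subst (φ (m * p) ≤_) (sym degree-Φ[mp]) (ℕₚ.m≤n+m _ δ))))
    F∣h : F ∣ₚ h
    F∣h = Φ-∣-∘ₚ⁻¹ h (truncation con i+δ<j)
    k≈0 : F∣h .quotient ≈ []
    k≈0 = Deg<0⇒≈0 (Deg<-cancelˡ mF (Deg<-≈ (F∣h .equality)
      (Deg<-mono (ℕₚ.≤-trans b<δ (ℕₚ.m≤m+n δ 0)) (Deg<-take (suc b) F))))
    h≈0 : h ≈ []
    h≈0 = ≈-trans (F∣h .equality) (≈-trans (⊗-congʳ F k≈0) (⊗-zeroʳ F))

  gap-attained : Consecutive (coef C) (m ∸ δ) m
  gap-attained = consecutive ρ<m cρ≢0 cm≢0 zeros
    where
    open ≡-Reasoning
    ρ = m ∸ δ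
    ρ<m : ρ < m
    ρ<m = ℕₚ.∸-monoʳ-< 0<δ δ≤m
    mΨ : Monic ρ Ψ
    mΨ = Monic-cancelˡ mF (Monic-≈ xᵐ-1≈FΨ
      (subst (λ d → Monic d (xⁿ-1 m)) (sym (ℕₚ.m+[n∸m]≡n δ≤m)) (Monic-xⁿ-1 m 0<m)))
    G = proj₁ (∘ₚ-head F p)
    rearrange₁ : ∀ x c → c ⊕ (x ⊕ ⊝ one) ⊗ c ≈ x ⊗ c
    rearrange₁ = Ring.solve-∀ solverRing
    rearrange₂ : ∀ f s c → (f ⊗ s) ⊗ c ≈ (f ⊗ c) ⊗ s
    rearrange₂ = Ring.solve-∀ solverRing
    rearrange₃ : ∀ c a x g s → c ⊕ (a ⊕ x ⊗ g) ⊗ s ≈ (c ⊕ a ⊗ s) ⊕ x ⊗ (g ⊗ s)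
    rearrange₃ = Ring.solve-∀ solverRing
    -- C + a₀ Ψ ≡ x^m C modulo x^p, from (x^m - 1) C = F(x^p) Ψ
    congruence : X^ m ⊗ C ≈ (C ⊕ const a₀ ⊗ Ψ) ⊕ X^ p ⊗ (G ⊗ Ψ)
    congruence = ≈-trans (≈-sym (rearrange₁ (X^ m) C))
      (≈-trans (⊕-cong (≈-refl {C})
        (≈-trans (⊗-cong (≈-trans (≈-sym (xⁿ-1≈ m)) xᵐ-1≈FΨ) (≈-refl {C}))
        (≈-trans (rearrange₂ F Ψ C)
        (⊗-cong (≈-trans (≈-sym FXᵖ≈FC) (proj₂ (∘ₚ-head F p))) (≈-refl {Ψ})))))
      (rearrange₃ C (const a₀) (X^ p) G Ψ))
    coefs : ∀ n → n < p → coef (X^ m ⊗ C) n ≡ coef C n ℤ.+ a₀ ℤ.* coef Ψ n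
    coefs n n<p = begin
      coef (X^ m ⊗ C) n                         ≡⟨ coef-low (C ⊕ const a₀ ⊗ Ψ) p (G ⊗ Ψ) congruence n<p ⟩
      coef (C ⊕ const a₀ ⊗ Ψ) n                 ≡⟨ coef-⊕ C (const a₀ ⊗ Ψ) n ⟩
      coef C n ℤ.+ coef (const a₀ ⊗ Ψ) n        ≡⟨ cong (λ z → coef C n ℤ.+ z) (trans (const-⊗ a₀ Ψ .at n) (coef-· a₀ Ψ n)) ⟩
      coef C n ℤ.+ a₀ ℤ.* coef Ψ n              ∎
    -- Below `m` the left side x^m C of the congruence has no terms, so the coefficients of C are
    -- those of Ψ times -F(0).
    low : ∀ n → n < m → coef C n ℤ.+ a₀ ℤ.* coef Ψ n ≡ 0ℤ
    low n n<m = trans (sym (coefs n (ℕₚ.<-trans n<m m<p))) (coef-X^⊗ m C n<m)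
    vanish : ∀ n → coef Ψ n ≡ 0ℤ → coef C n ℤ.+ a₀ ℤ.* coef Ψ n ≡ coef C n
    vanish n ψ≡0 = trans (cong (λ z → coef C n ℤ.+ a₀ ℤ.* z) ψ≡0)
      (trans (cong (λ z → coef C n ℤ.+ z) (ℤₚ.*-zeroʳ a₀)) (ℤₚ.+-identityʳ _))
    nonzero : ∀ n → n < m → a₀ ℤ.* coef Ψ n ≢ 0ℤ → coef C n ≢ 0ℤ
    nonzero n n<m aψ≢0 c≡0 = aψ≢0 (trans (sym (ℤₚ.+-identityˡ _))
      (trans (cong (ℤ._+ a₀ ℤ.* coef Ψ n) (sym c≡0)) (low n n<m)))
    zeros : ∀ n → ρ < n → n < m → coef C n ≡ 0ℤ
    zeros n ρ<n n<m = trans (sym (vanish n (mΨ .deg .above n ρ<n))) (low n n<m)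
    cρ≢0 : coef C ρ ≢ 0ℤ
    cρ≢0 = nonzero ρ ρ<m λ aψ≡0 → a₀≢0 (trans (sym (ℤₚ.*-identityʳ a₀))
      (trans (cong (a₀ ℤ.*_) (sym (mΨ .lead))) aψ≡0))
    c₀≢0 : coef C 0 ≢ 0ℤ
    c₀≢0 = nonzero 0 0<m λ aψ≡0 → contradiction (trans (sym a₀ψ₀≡-1) aψ≡0) λ ()
    -- At `m` the polynomial Ψ has already ended, since its degree is m - δ < m, and m < p keeps the
    -- congruence valid there; so C repeats its constant term.
    cm≡c₀ : coef C m ≡ coef C 0
    cm≡c₀ = begin
      coef C m                          ≡⟨ vanish m (mΨ .deg .above m ρ<m) ⟨
      coef C m ℤ.+ a₀ ℤ.* coef Ψ m      ≡⟨ coefs m m<p ⟨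
      coef (X^ m ⊗ C) m                 ≡⟨ cong (coef (X^ m ⊗ C)) (ℕₚ.+-identityʳ m) ⟨
      coef (X^ m ⊗ C) (m + 0)           ≡⟨ coef-X^⊗-+ m C 0 ⟩
      coef C 0                          ∎
    cm≢0 : coef C m ≢ 0ℤ
    cm≢0 = c₀≢0 ∘ trans (sym cm≡c₀)

  maxGap-Φ[mp] : maxGap C ≡ δ
  maxGap-Φ[mp] = ℕₚ.≤-antisym (maxGap-≤ C gap-≤)
    (subst (_≤ maxGap C) (ℕₚ.m∸[m∸n]≡n δ≤m) (maxGap-≥ C gap-attained))

mainTheorem1 : (m p : ℕ) → 0 < m → ¬ (2 ∣ m) → SquareFree m → Prime p → m < p → maxGap (Φ (m * p)) ≡ φ m
mainTheorem1 m p 0<m _ _ pr m<p = maxGap-Φ[mp] 0<m pr m<p
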